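{- Let $a,b$ be non-negative integers and $c=1$ such that the polynomial $x^3-ax^2-bx-c$ has exactly one real root $\eta_1$, and $\eta_1>1$. Then there exists a constant $T$ such that for any positive integers $n,k$ with $k\ge 4$, the number of positive integer sequences $\langle x_i\rangle_{i=1}^k$ satisfying $x_{i+3}=ax_{i+2}+bx_{i+1}+cx_i$ for $1\le i\le k-3$ and terminating at $x_k=n$ is at most \[\left\lceil T\frac{n}{\eta_1^{3k/2}}\right\rceil^2.\]
   Context: A sequence $\langle x_i\rangle_{i=1}^k$ is positive if $x_1,x_2,x_3>0$.
   Formalization: The bound is stated for n and k for which the number of sequences is finite; as printed the claim fails when infinitely many sequences end at n, e.g. a=1, b=0, k=4, n=2, where x_1=x_3=1 and x_2 is arbitrary. -}

module Defs where

open import Data.Fin.Base using (Fin; toℕ)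
open import Data.Integer.Base as ℤ using (ℤ; +_; +[1+_]; -[1+_])
import Data.Integer.Properties as ℤP
open import Data.List.Base using (List; length)
open import Data.List.Membership.Propositional using (_∈_)
open import Data.List.Relation.Unary.Unique.Propositional using (Unique)
open import Data.Nat.Base as ℕ using (ℕ; zero; suc)
import Data.Nat.Properties as ℕP
open import Data.Product.Base using (∃; _×_; _,_; proj₁; proj₂)
open import Data.Rational.Base
open import Data.Rational.Properties
open import Data.Rational.Solver using (module +-*-Solver)
import Data.Rational.Unnormalised.Base as ℚᵘ
import Data.Rational.Unnormalised.Properties as ℚᵘP
open import Data.Sum.Base using (inj₁; inj₂)
open import Data.Vec.Base using (Vec; lookup)
open import Function.Bundles using (_⇔_)
open import Relation.Binary.PropositionalEquality
  using (_≡_; refl; sym; trans; cong; cong₂; subst; subst₂; module ≡-Reasoning)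
open import Relation.Nullary using (¬_; Dec; yes; no)

open +-*-Solver using (solve; con; _:+_; _:*_; _:-_; :-_; _:=_)

fromℤ : ℤ → ℚ
fromℤ i = i / 1

fromℕ : ℕ → ℚ
fromℕ j = fromℤ (+ j)

0≤-*-0≤ : ∀ {p q} → 0ℚ ≤ p → 0ℚ ≤ q → 0ℚ ≤ p * q
0≤-*-0≤ {p} {q} 0≤p 0≤q = nonNegative⁻¹ (p * q)
  {{nonNeg*nonNeg⇒nonNeg p {{nonNegative 0≤p}} q {{nonNegative 0≤q}}}}

0<-*-0< : ∀ {p q} → 0ℚ < p → 0ℚ < q → 0ℚ < p * q
0<-*-0< {p} {q} 0<p 0<q = positive⁻¹ (p * q)
  {{pos*pos⇒pos p {{positive 0<p}} q {{positive 0<q}}}}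

0<-+-0≤ : ∀ {p q} → 0ℚ < p → 0ℚ ≤ q → 0ℚ < p + q
0<-+-0≤ {p} {q} 0<p 0≤q = subst (_< p + q) (+-identityʳ 0ℚ) (+-mono-<-≤ 0<p 0≤q)

*-mono-≤-0≤ : ∀ {p q r s} → 0ℚ ≤ p → 0ℚ ≤ r → p ≤ q → r ≤ s → p * r ≤ q * s
*-mono-≤-0≤ {p} {q} {r} {s} 0≤p 0≤r p≤q r≤s = ≤-trans
  (*-monoʳ-≤-nonNeg r {{nonNegative 0≤r}} p≤q)
  (*-monoˡ-≤-nonNeg q {{nonNegative (≤-trans 0≤p p≤q)}} r≤s)

square-< : ∀ {p q} → 0ℚ ≤ p → p < q → p * p < q * q
square-< {p} {q} 0≤p p<q = ≤-<-trans
  (*-monoˡ-≤-nonNeg p {{nonNegative 0≤p}} (<⇒≤ p<q))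
  (*-monoˡ-<-pos q {{positive (≤-<-trans 0≤p p<q)}} p<q)

p-q<r⇒p<q+r : ∀ {p q r} → p - q < r → p < q + r
p-q<r⇒p<q+r {p} {q} {r} lt = subst (_< q + r)
  (solve 2 (λ p q → q :+ (p :- q) := p) refl p q) (+-monoʳ-< q lt)

p≤∣p∣ : ∀ p → p ≤ ∣ p ∣
p≤∣p∣ p with ≤-total 0ℚ p
... | inj₁ 0≤p = ≤-reflexive (sym (0≤p⇒∣p∣≡p 0≤p))
... | inj₂ p≤0 = ≤-trans p≤0 (0≤∣p∣ p)

∣-∣-< : ∀ {p r} → p < r → - p < r → ∣ p ∣ < r
∣-∣-< {p} {r} p<r -p<r with ∣p∣≡p∨∣p∣≡-p p
... | inj₁ eq = subst (_< r) (sym eq) p<r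
... | inj₂ eq = subst (_< r) (sym eq) -p<r

neg-sub : ∀ p q → - (p - q) ≡ q - p
neg-sub = solve 2 (λ p q → :- (p :- q) := q :- p) refl

∣-∣-swap : ∀ p q → ∣ p - q ∣ ≡ ∣ q - p ∣
∣-∣-swap p q = trans (sym (∣-p∣≡∣p∣ (p - q))) (cong ∣_∣ (neg-sub p q))

∣-∣-bound : ∀ {p q r} → ∣ p - q ∣ < r → ∣ p ∣ ≤ ∣ q ∣ + r
∣-∣-bound {p} {q} {r} lt = begin
  ∣ p ∣             ≡⟨ cong ∣_∣ (solve 2 (λ p q → p := q :+ (p :- q)) refl p q) ⟩
  ∣ q + (p - q) ∣   ≤⟨ ∣p+q∣≤∣p∣+∣q∣ q (p - q) ⟩
  ∣ q ∣ + ∣ p - q ∣ ≤⟨ +-monoʳ-≤ ∣ q ∣ (<⇒≤ lt) ⟩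
  ∣ q ∣ + r         ∎
  where open ≤-Reasoning

∣-∣-*-< : ∀ {p q B δ} → 0ℚ < B → ∣ p ∣ ≤ B → ∣ q ∣ < δ → ∣ p * q ∣ < B * δ
∣-∣-*-< {p} {q} {B} {δ} 0<B p≤B q<δ = begin-strict
  ∣ p * q ∣     ≡⟨ ∣p*q∣≡∣p∣*∣q∣ p q ⟩
  ∣ p ∣ * ∣ q ∣ ≤⟨ *-monoʳ-≤-nonNeg ∣ q ∣ {{∣-∣-nonNeg q}} p≤B ⟩
  B * ∣ q ∣     <⟨ *-monoʳ-<-pos B {{positive 0<B}} q<δ ⟩
  B * δ         ∎
  where open ≤-Reasoning

0<1 : 0ℚ < 1ℚ
0<1 = positive⁻¹ 1ℚ

0<⊓ : ∀ {p q} → 0ℚ < p → 0ℚ < q → 0ℚ < p ⊓ q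
0<⊓ {p} {q} 0<p 0<q with ≤-total p q
... | inj₁ p≤q = subst (0ℚ <_) (sym (p≤q⇒p⊓q≡p p≤q)) 0<p
... | inj₂ q≤p = subst (0ℚ <_) (sym (p≥q⇒p⊓q≡q q≤p)) 0<q

<⇒≱ : ∀ {p q} → p < q → ¬ (q ≤ p)
<⇒≱ p<q q≤p = <-irrefl refl (<-≤-trans p<q q≤p)

0≤-+-0≤ : ∀ {p q} → 0ℚ ≤ p → 0ℚ ≤ q → 0ℚ ≤ p + q
0≤-+-0≤ {p} {q} 0≤p 0≤q = subst (_≤ p + q) (+-identityʳ 0ℚ) (+-mono-≤ 0≤p 0≤q)

0<∣p∣+1 : ∀ p → 0ℚ < ∣ p ∣ + 1ℚ
0<∣p∣+1 p = subst (0ℚ <_) (+-comm 1ℚ ∣ p ∣) (0<-+-0≤ {1ℚ} {∣ p ∣} 0<1 (0≤∣p∣ p))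

0<½ : 0ℚ < ½
0<½ = positive⁻¹ ½

half : ℚ → ℚ
half ε = ε * ½

half-sum : ∀ ε → half ε + half ε ≡ ε
half-sum ε = trans (sym (*-distribˡ-+ ε ½ ½)) (*-identityʳ ε)

0<half : ∀ {ε} → 0ℚ < ε → 0ℚ < half ε
0<half 0<ε = 0<-*-0< {_} {½} 0<ε 0<½

recip : (q : ℚ) → 0ℚ < q → ℚ
recip q 0<q = (1/ q) {{pos⇒nonZero q {{positive 0<q}}}}

recip-inv : ∀ q (0<q : 0ℚ < q) → q * recip q 0<q ≡ 1ℚ
recip-inv q 0<q = *-inverseʳ q {{pos⇒nonZero q {{positive 0<q}}}}

0<recip : ∀ q (0<q : 0ℚ < q) → 0ℚ < recip q 0<q
0<recip q 0<q = positive⁻¹ (recip q 0<q) {{1/pos⇒pos q {{positive 0<q}}}}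

IsCauchy : (ℕ → ℚ) → Set
IsCauchy f = ∀ ε → 0ℚ < ε →
  ∃ λ N → ∀ m n → N ℕ.≤ m → N ℕ.≤ n → ∣ f m - f n ∣ < ε

-- Cauchy sequences of rationals with a modulus, compared up to _≈ᴿ_.
record ℝ : Set where
  constructor mkℝ
  field
    seq    : ℕ → ℚ
    cauchy : IsCauchy seq

open ℝ public

infix 4 _≈ᴿ_ _<ᴿ_ _≤ᴿ_

_≈ᴿ_ : ℝ → ℝ → Set
x ≈ᴿ y = ∀ ε → 0ℚ < ε → ∃ λ N → ∀ n → N ℕ.≤ n → ∣ seq x n - seq y n ∣ < ε

_<ᴿ_ : ℝ → ℝ → Set
x <ᴿ y = ∃ λ ε → 0ℚ < ε × ∃ λ N → ∀ n → N ℕ.≤ n → seq x n + ε ≤ seq y n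

_≤ᴿ_ : ℝ → ℝ → Set
x ≤ᴿ y = ¬ (y <ᴿ x)

ℚ→ℝ : ℚ → ℝ
ℚ→ℝ q = mkℝ (λ _ → q) λ ε 0<ε → 0 , λ _ _ _ _ →
  subst (λ p → ∣ p ∣ < ε) (sym (+-inverseʳ q)) 0<ε

ℤ→ℝ : ℤ → ℝ
ℤ→ℝ i = ℚ→ℝ (fromℤ i)

ℕ→ℝ : ℕ → ℝ
ℕ→ℝ n = ℤ→ℝ (+ n)

0ᴿ 1ᴿ : ℝ
0ᴿ = ℚ→ℝ 0ℚ
1ᴿ = ℚ→ℝ 1ℚ

+-cauchy : ∀ x y → IsCauchy (λ n → seq x n + seq y n)
+-cauchy x y ε 0<ε with cauchy x (half ε) (0<half 0<ε) | cauchy y (half ε) (0<half 0<ε)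
... | N , hx | M , hy = N ℕ.⊔ M , λ m n m≥ n≥ → begin-strict
  ∣ (seq x m + seq y m) - (seq x n + seq y n) ∣
    ≡⟨ cong ∣_∣ (solve 4 (λ a b c d → (a :+ b) :- (c :+ d) := (a :- c) :+ (b :- d)) refl
         (seq x m) (seq y m) (seq x n) (seq y n)) ⟩
  ∣ (seq x m - seq x n) + (seq y m - seq y n) ∣
    ≤⟨ ∣p+q∣≤∣p∣+∣q∣ (seq x m - seq x n) (seq y m - seq y n) ⟩
  ∣ seq x m - seq x n ∣ + ∣ seq y m - seq y n ∣
    <⟨ +-mono-< (hx m n (ℕP.m⊔n≤o⇒m≤o N M m≥) (ℕP.m⊔n≤o⇒m≤o N M n≥))
                (hy m n (ℕP.m⊔n≤o⇒n≤o N M m≥) (ℕP.m⊔n≤o⇒n≤o N M n≥)) ⟩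
  half ε + half ε ≡⟨ half-sum ε ⟩
  ε ∎
  where open ≤-Reasoning

neg-cauchy : ∀ x → IsCauchy (λ n → - seq x n)
neg-cauchy x ε 0<ε with cauchy x ε 0<ε
... | N , h = N , λ m n m≥ n≥ → subst (_< ε)
  (trans (∣-∣-swap (seq x m) (seq x n))
    (cong ∣_∣ (solve 2 (λ a b → b :- a := (:- a) :- (:- b)) refl (seq x m) (seq x n))))
  (h m n m≥ n≥)

*-cauchy : ∀ x y → IsCauchy (λ n → seq x n * seq y n)
*-cauchy x y ε 0<ε with cauchy x 1ℚ 0<1 | cauchy y 1ℚ 0<1
... | N₁ , bx | M₁ , by = K , main
  where
  B C δ : ℚ
  B = ∣ seq x N₁ ∣ + 1ℚ
  C = ∣ seq y M₁ ∣ + 1ℚ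

  0<B : 0ℚ < B
  0<B = 0<∣p∣+1 (seq x N₁)

  0<C : 0ℚ < C
  0<C = 0<∣p∣+1 (seq y M₁)

  0<B+C : 0ℚ < B + C
  0<B+C = 0<-+-0≤ {B} {C} 0<B (<⇒≤ 0<C)

  δ = ε * recip (B + C) 0<B+C

  0<δ : 0ℚ < δ
  0<δ = 0<-*-0< {ε} {recip (B + C) 0<B+C} 0<ε (0<recip (B + C) 0<B+C)

  δ-eq : B * δ + C * δ ≡ ε
  δ-eq = begin
    B * δ + C * δ
      ≡⟨ solve 4 (λ b c e r → b :* (e :* r) :+ c :* (e :* r) := e :* ((b :+ c) :* r)) refl
           B C ε (recip (B + C) 0<B+C) ⟩
    ε * ((B + C) * recip (B + C) 0<B+C) ≡⟨ cong (ε *_) (recip-inv (B + C) 0<B+C) ⟩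
    ε * 1ℚ ≡⟨ *-identityʳ ε ⟩
    ε ∎
    where open ≡-Reasoning

  N₂ M₂ K : ℕ
  N₂ = proj₁ (cauchy x δ 0<δ)
  M₂ = proj₁ (cauchy y δ 0<δ)
  K = (N₁ ℕ.⊔ M₁) ℕ.⊔ (N₂ ℕ.⊔ M₂)

  main : ∀ m n → K ℕ.≤ m → K ℕ.≤ n → ∣ seq x m * seq y m - seq x n * seq y n ∣ < ε
  main m n m≥ n≥ = begin-strict
    ∣ seq x m * seq y m - seq x n * seq y n ∣
      ≡⟨ cong ∣_∣ (solve 4 (λ a b c d → a :* b :- c :* d := a :* (b :- d) :+ d :* (a :- c)) refl
           (seq x m) (seq y m) (seq x n) (seq y n)) ⟩
    ∣ seq x m * (seq y m - seq y n) + seq y n * (seq x m - seq x n) ∣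
      ≤⟨ ∣p+q∣≤∣p∣+∣q∣ (seq x m * (seq y m - seq y n)) (seq y n * (seq x m - seq x n)) ⟩
    ∣ seq x m * (seq y m - seq y n) ∣ + ∣ seq y n * (seq x m - seq x n) ∣
      <⟨ +-mono-<
           (∣-∣-*-< {seq x m} {seq y m - seq y n} {B} {δ} 0<B
             (∣-∣-bound {seq x m} {seq x N₁} {1ℚ} (bx m N₁ N₁≤m ℕP.≤-refl))
             (proj₂ (cauchy y δ 0<δ) m n (M₂≤ m≥) (M₂≤ n≥)))
           (∣-∣-*-< {seq y n} {seq x m - seq x n} {C} {δ} 0<C
             (∣-∣-bound {seq y n} {seq y M₁} {1ℚ} (by n M₁ M₁≤n ℕP.≤-refl))
             (proj₂ (cauchy x δ 0<δ) m n (N₂≤ m≥) (N₂≤ n≥))) ⟩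
    B * δ + C * δ ≡⟨ δ-eq ⟩
    ε ∎
    where
    open ≤-Reasoning
    N₁≤m = ℕP.m⊔n≤o⇒m≤o N₁ M₁ (ℕP.m⊔n≤o⇒m≤o (N₁ ℕ.⊔ M₁) (N₂ ℕ.⊔ M₂) m≥)
    M₁≤n = ℕP.m⊔n≤o⇒n≤o N₁ M₁ (ℕP.m⊔n≤o⇒m≤o (N₁ ℕ.⊔ M₁) (N₂ ℕ.⊔ M₂) n≥)
    N₂≤ : ∀ {k} → K ℕ.≤ k → N₂ ℕ.≤ k
    N₂≤ k≥ = ℕP.m⊔n≤o⇒m≤o N₂ M₂ (ℕP.m⊔n≤o⇒n≤o (N₁ ℕ.⊔ M₁) (N₂ ℕ.⊔ M₂) k≥)
    M₂≤ : ∀ {k} → K ℕ.≤ k → M₂ ℕ.≤ k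
    M₂≤ k≥ = ℕP.m⊔n≤o⇒n≤o N₂ M₂ (ℕP.m⊔n≤o⇒n≤o (N₁ ℕ.⊔ M₁) (N₂ ℕ.⊔ M₂) k≥)

infix  8 -ᴿ_
infixl 6 _+ᴿ_ _-ᴿ_
infixl 7 _*ᴿ_
infixr 8 _^ᴿ_

_+ᴿ_ : ℝ → ℝ → ℝ
x +ᴿ y = mkℝ (λ n → seq x n + seq y n) (+-cauchy x y)

-ᴿ_ : ℝ → ℝ
-ᴿ x = mkℝ (λ n → - seq x n) (neg-cauchy x)

_-ᴿ_ : ℝ → ℝ → ℝ
x -ᴿ y = x +ᴿ (-ᴿ y)

_*ᴿ_ : ℝ → ℝ → ℝ
x *ᴿ y = mkℝ (λ n → seq x n * seq y n) (*-cauchy x y)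

_^ᴿ_ : ℝ → ℕ → ℝ
x ^ᴿ zero  = 1ᴿ
x ^ᴿ suc n = x *ᴿ x ^ᴿ n

-- If ε ≤ xₙ eventually, then max(ε, xₙ) = xₙ eventually, and 1 / max(ε, xₙ)
-- is defined for every n.
module Inverse (x : ℝ) (0<x : 0ᴿ <ᴿ x) where

  ε₀ : ℚ
  ε₀ = proj₁ 0<x

  0<ε₀ : 0ℚ < ε₀
  0<ε₀ = proj₁ (proj₂ 0<x)

  u : ℕ → ℚ
  u n = ε₀ ⊔ seq x n

  0<u : ∀ n → 0ℚ < u n
  0<u n = <-≤-trans 0<ε₀ (p≤p⊔q ε₀ (seq x n))

  v : ℕ → ℚ
  v n = recip (u n) (0<u n)

  r₀ : ℚ
  r₀ = recip ε₀ 0<ε₀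

  0<r₀ : 0ℚ < r₀
  0<r₀ = 0<recip ε₀ 0<ε₀

  v≤r₀ : ∀ n → ∣ v n ∣ ≤ r₀
  v≤r₀ n = begin
    ∣ v n ∣          ≡⟨ 0≤p⇒∣p∣≡p (<⇒≤ (0<recip (u n) (0<u n))) ⟩
    v n              ≡⟨ *-identityʳ (v n) ⟨
    v n * 1ℚ         ≡⟨ cong (v n *_) (recip-inv ε₀ 0<ε₀) ⟨
    v n * (ε₀ * r₀)  ≤⟨ *-monoˡ-≤-nonNeg (v n) {{nonNegative (<⇒≤ (0<recip (u n) (0<u n)))}}
                          (*-monoʳ-≤-nonNeg r₀ {{nonNegative (<⇒≤ 0<r₀)}} (p≤p⊔q ε₀ (seq x n))) ⟩
    v n * (u n * r₀) ≡⟨ solve 3 (λ a b c → a :* (b :* c) := (b :* a) :* c) refl (v n) (u n) r₀ ⟩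
    (u n * v n) * r₀ ≡⟨ cong (_* r₀) (recip-inv (u n) (0<u n)) ⟩
    1ℚ * r₀          ≡⟨ *-identityˡ r₀ ⟩
    r₀               ∎
    where open ≤-Reasoning

  N₀ : ℕ
  N₀ = proj₁ (proj₂ (proj₂ 0<x))

  u≡x : ∀ n → N₀ ℕ.≤ n → u n ≡ seq x n
  u≡x n n≥ = p≤q⇒p⊔q≡q
    (subst (_≤ seq x n) (+-identityˡ ε₀) (proj₂ (proj₂ (proj₂ 0<x)) n n≥))

  v-diff : ∀ m n → v m - v n ≡ v m * (v n * (u n - u m))
  v-diff m n = sym (begin
    v m * (v n * (u n - u m))
      ≡⟨ solve 4 (λ a b c d → a :* (b :* (c :- d)) := a :* (c :* b) :- (d :* a) :* b) refl
           (v m) (v n) (u n) (u m) ⟩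
    v m * (u n * v n) - (u m * v m) * v n
      ≡⟨ cong₂ (λ s t → v m * s - t * v n) (recip-inv (u n) (0<u n)) (recip-inv (u m) (0<u m)) ⟩
    v m * 1ℚ - 1ℚ * v n
      ≡⟨ cong₂ _-_ (*-identityʳ (v m)) (*-identityˡ (v n)) ⟩
    v m - v n ∎)
    where open ≡-Reasoning

  v-cauchy : IsCauchy v
  v-cauchy ε 0<ε with cauchy x (ε₀ * (ε₀ * ε)) (0<-*-0< {ε₀} {ε₀ * ε} 0<ε₀ (0<-*-0< {ε₀} {ε} 0<ε₀ 0<ε))
  ... | M , h = N₀ ℕ.⊔ M , λ m n m≥ n≥ → begin-strict
    ∣ v m - v n ∣ ≡⟨ cong ∣_∣ (v-diff m n) ⟩
    ∣ v m * (v n * (u n - u m)) ∣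
      ≡⟨ cong (λ d → ∣ v m * (v n * d) ∣)
           (cong₂ _-_ (u≡x n (ℕP.m⊔n≤o⇒m≤o N₀ M n≥)) (u≡x m (ℕP.m⊔n≤o⇒m≤o N₀ M m≥))) ⟩
    ∣ v m * (v n * (seq x n - seq x m)) ∣
      <⟨ ∣-∣-*-< {v m} {v n * (seq x n - seq x m)} {r₀} {r₀ * (ε₀ * (ε₀ * ε))} 0<r₀ (v≤r₀ m)
           (∣-∣-*-< {v n} {seq x n - seq x m} {r₀} {ε₀ * (ε₀ * ε)} 0<r₀ (v≤r₀ n)
           (h n m (ℕP.m⊔n≤o⇒n≤o N₀ M n≥) (ℕP.m⊔n≤o⇒n≤o N₀ M m≥))) ⟩
    r₀ * (r₀ * (ε₀ * (ε₀ * ε)))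
      ≡⟨ solve 3 (λ r e t → r :* (r :* (e :* (e :* t))) := ((e :* r) :* (e :* r)) :* t) refl r₀ ε₀ ε ⟩
    ((ε₀ * r₀) * (ε₀ * r₀)) * ε
      ≡⟨ cong (λ s → (s * s) * ε) (recip-inv ε₀ 0<ε₀) ⟩
    (1ℚ * 1ℚ) * ε
      ≡⟨ *-identityˡ ε ⟩
    ε ∎
    where open ≤-Reasoning

  inverse : ℝ
  inverse = mkℝ v v-cauchy

divide : ℝ → (y : ℝ) → 0ᴿ <ᴿ y → ℝ
divide x y 0<y = x *ᴿ Inverse.inverse y 0<y

syntax divide x y 0<y = x ÷ᴿ y [ 0<y ]

module SquareRoot where

  step : ℕ → ℚ
  step d = + 1 / suc d

  grid : ℕ → ℕ → ℚ
  grid d j = fromℕ j * step d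

  square : ℚ → ℚ
  square p = p * p

  -- The largest j ≤ b with P j, or 0 if there is none.
  search : {P : ℕ → Set} → (∀ j → Dec (P j)) → ℕ → ℕ
  search P? zero = zero
  search P? (suc b) with P? (suc b)
  ... | yes _ = suc b
  ... | no  _ = search P? b

  Below : ℚ → ℕ → ℕ → Set
  Below q d j = square (grid d j) ≤ q

  below? : ∀ q d j → Dec (Below q d j)
  below? q d j = square (grid d j) ≤? q

  bound : ℚ → ℕ → ℕ
  bound q d = suc d ℕ.* suc ℤ.∣ ↥ q ∣

  fromℕ-suc : ∀ j → fromℕ (suc j) ≡ 1ℚ + fromℕ j
  fromℕ-suc j = toℚᵘ-injective (begin
    toℚᵘ (fromℕ (suc j))        ≈⟨ toℚᵘ-fromℚᵘ (ℚᵘ.mkℚᵘ (+ suc j) 0) ⟩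
    ℚᵘ.mkℚᵘ (+ suc j) 0         ≈⟨ ℚᵘ.*≡* (cong (λ i → (+ 1 ℤ.+ i) ℤ.* + 1)
                                       (sym (ℤP.*-identityʳ (+ j)))) ⟩
    ℚᵘ.1ℚᵘ ℚᵘ.+ ℚᵘ.mkℚᵘ (+ j) 0 ≈⟨ ℚᵘP.+-congʳ ℚᵘ.1ℚᵘ (toℚᵘ-fromℚᵘ (ℚᵘ.mkℚᵘ (+ j) 0)) ⟨
    ℚᵘ.1ℚᵘ ℚᵘ.+ toℚᵘ (fromℕ j)  ≈⟨ toℚᵘ-homo-+ 1ℚ (fromℕ j) ⟨
    toℚᵘ (1ℚ + fromℕ j)         ∎)
    where open ℚᵘP.≃-Reasoning

  0<step : ∀ d → 0ℚ < step d
  0<step d = positive⁻¹ (step d) {{normalize-pos 1 (suc d)}}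

  0≤fromℕ : ∀ j → 0ℚ ≤ fromℕ j
  0≤fromℕ j = nonNegative⁻¹ (fromℕ j) {{normalize-nonNeg j 1}}

  0≤grid : ∀ d j → 0ℚ ≤ grid d j
  0≤grid d j = 0≤-*-0≤ {fromℕ j} {step d} (0≤fromℕ j) (<⇒≤ (0<step d))

  grid-suc : ∀ d j → grid d (suc j) ≡ grid d j + step d
  grid-suc d j = begin
    fromℕ (suc j) * step d     ≡⟨ cong (_* step d) (fromℕ-suc j) ⟩
    (1ℚ + fromℕ j) * step d    ≡⟨ *-distribʳ-+ (step d) 1ℚ (fromℕ j) ⟩
    1ℚ * step d + grid d j     ≡⟨ cong (_+ grid d j) (*-identityˡ (step d)) ⟩
    step d + grid d j          ≡⟨ +-comm (step d) (grid d j) ⟩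
    grid d j + step d          ∎
    where open ≡-Reasoning

  step-mono : ∀ {d e} → d ℕ.≤ e → step e ≤ step d
  step-mono {d} {e} d≤e = toℚᵘ-cancel-≤ (begin
    toℚᵘ (step e)      ≃⟨ toℚᵘ-fromℚᵘ (ℚᵘ.mkℚᵘ (+ 1) e) ⟩
    ℚᵘ.mkℚᵘ (+ 1) e    ≤⟨ ℚᵘ.*≤* (ℤ.+≤+ (ℕP.+-monoˡ-≤ 0 (ℕ.s≤s d≤e))) ⟩
    ℚᵘ.mkℚᵘ (+ 1) d    ≃⟨ toℚᵘ-fromℚᵘ (ℚᵘ.mkℚᵘ (+ 1) d) ⟨
    toℚᵘ (step d)      ∎)
    where open ℚᵘP.≤-Reasoning

  archimedean : ∀ ε → 0ℚ < ε → ∃ λ d → step d ≤ ε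
  archimedean (mkℚ (+ zero)  d c) (*<* (ℤ.+<+ ()))
  archimedean (mkℚ -[1+ _ ]  d c) (*<* ())
  archimedean ε@(mkℚ +[1+ p ] d c) _ = d , toℚᵘ-cancel-≤ (begin
    toℚᵘ (step d)      ≃⟨ toℚᵘ-fromℚᵘ (ℚᵘ.mkℚᵘ (+ 1) d) ⟩
    ℚᵘ.mkℚᵘ (+ 1) d    ≤⟨ ℚᵘ.*≤* (ℤ.+≤+ (ℕP.*-monoˡ-≤ (suc d) (ℕ.s≤s (ℕ.z≤n {p})))) ⟩
    toℚᵘ ε             ∎)
    where open ℚᵘP.≤-Reasoning

  search-lower : ∀ {P : ℕ → Set} (P? : ∀ j → Dec (P j)) b → P 0 → P (search P? b)
  search-lower P? zero p₀ = p₀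
  search-lower P? (suc b) p₀ with P? (suc b)
  ... | yes p = p
  ... | no  _ = search-lower P? b p₀

  search-upper : ∀ {P : ℕ → Set} (P? : ∀ j → Dec (P j)) b →
                 ¬ P (suc b) → ¬ P (suc (search P? b))
  search-upper P? zero ¬p = ¬p
  search-upper P? (suc b) ¬p with P? (suc b)
  ... | yes _   = ¬p
  ... | no  ¬p′ = search-upper P? b ¬p′

  q<num : ∀ q → q < fromℕ (suc ℤ.∣ ↥ q ∣)
  q<num q@(mkℚ i d c) = toℚᵘ-cancel-< (begin-strict
    toℚᵘ q                          <⟨ ℚᵘ.*<* lt ⟩
    ℚᵘ.mkℚᵘ (+ suc ℤ.∣ i ∣) 0       ≃⟨ toℚᵘ-fromℚᵘ (ℚᵘ.mkℚᵘ (+ suc ℤ.∣ i ∣) 0) ⟨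
    toℚᵘ (fromℕ (suc ℤ.∣ i ∣))      ∎)
    where
    open ℚᵘP.≤-Reasoning
    i≤ : ∀ i → i ℤ.≤ + ℤ.∣ i ∣
    i≤ (+ n)    = ℤP.≤-refl
    i≤ -[1+ n ] = ℤ.-≤+
    lt : i ℤ.* + 1 ℤ.< + suc ℤ.∣ i ∣ ℤ.* + suc d
    lt = subst (ℤ._< + (suc ℤ.∣ i ∣ ℕ.* suc d)) (sym (ℤP.*-identityʳ i)) (ℤP.≤-<-trans (i≤ i)
      (ℤ.+<+ (ℕP.≤-trans (ℕP.≤-reflexive (sym (ℕP.*-identityʳ (suc ℤ.∣ i ∣))))
        (ℕP.*-monoʳ-≤ (suc ℤ.∣ i ∣) {1} {suc d} (ℕ.s≤s ℕ.z≤n)))))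

  grid-int : ∀ d k → grid d (suc d ℕ.* k) ≡ fromℕ k
  grid-int d k = toℚᵘ-injective (begin
    toℚᵘ (grid d (suc d ℕ.* k))
      ≈⟨ toℚᵘ-homo-* (fromℕ (suc d ℕ.* k)) (step d) ⟩
    toℚᵘ (fromℕ (suc d ℕ.* k)) ℚᵘ.* toℚᵘ (step d)
      ≈⟨ ℚᵘP.*-cong (toℚᵘ-fromℚᵘ (ℚᵘ.mkℚᵘ (+ (suc d ℕ.* k)) 0)) (toℚᵘ-fromℚᵘ (ℚᵘ.mkℚᵘ (+ 1) d)) ⟩
    ℚᵘ.mkℚᵘ (+ (suc d ℕ.* k)) 0 ℚᵘ.* ℚᵘ.mkℚᵘ (+ 1) d
      ≈⟨ ℚᵘ.*≡* eq ⟩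
    ℚᵘ.mkℚᵘ (+ k) 0
      ≈⟨ toℚᵘ-fromℚᵘ (ℚᵘ.mkℚᵘ (+ k) 0) ⟨
    toℚᵘ (fromℕ k) ∎)
    where
    open ℚᵘP.≃-Reasoning
    eq : (+ (suc d ℕ.* k) ℤ.* + 1) ℤ.* + 1 ≡ + k ℤ.* + (suc (d ℕ.+ 0))
    eq = trans (ℤP.*-identityʳ _) (trans (ℤP.*-identityʳ _)
      (trans (cong +_ (trans (ℕP.*-comm (suc d) k)
        (cong (λ e → k ℕ.* suc e) (sym (ℕP.+-identityʳ d)))))
        (ℤP.pos-* k (suc (d ℕ.+ 0)))))

  bound-ok : ∀ q d → q < square (grid d (suc (bound q d)))
  bound-ok q d = begin-strict
    q                     <⟨ q<num q ⟩
    M                     ≡⟨ *-identityʳ M ⟨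
    M * 1ℚ                ≤⟨ *-monoˡ-≤-nonNeg M {{nonNegative 0≤M}} 1≤M ⟩
    square M              <⟨ square-< 0≤M M<grid ⟩
    square (grid d (suc (bound q d))) ∎
    where
    open ≤-Reasoning
    k = ℤ.∣ ↥ q ∣
    M = fromℕ (suc k)
    0≤M : 0ℚ ≤ M
    0≤M = 0≤fromℕ (suc k)
    1≤M : 1ℚ ≤ M
    1≤M = subst₂ _≤_ (+-identityʳ 1ℚ) (sym (fromℕ-suc k)) (+-monoʳ-≤ 1ℚ (0≤fromℕ k))
    M<grid : M < grid d (suc (bound q d))
    M<grid = subst₂ _<_ (trans (+-identityʳ _) (grid-int d (suc k)))
      (sym (grid-suc d (bound q d))) (+-monoʳ-< (grid d (bound q d)) (0<step d))

  -- Abstract for typechecking speed; the lemmas characterise the values.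
  abstract

    -- ⌊√q (d + 1)⌋ / (d + 1)
    approx : ℚ → ℕ → ℚ
    approx q d = grid d (search (below? q d) (bound q d))

    0≤approx : ∀ q d → 0ℚ ≤ approx q d
    0≤approx q d = 0≤grid d (search (below? q d) (bound q d))

    approx-lower : ∀ q d → 0ℚ ≤ q → square (approx q d) ≤ q
    approx-lower q d 0≤q = search-lower {Below q d} (below? q d) (bound q d)
      (subst (_≤ q) (sym (trans (cong square (*-zeroˡ (step d))) (*-zeroˡ 0ℚ))) 0≤q)

    approx-upper : ∀ q d → q < square (approx q d + step d)
    approx-upper q d = subst (λ g → q < square g) (grid-suc d (search (below? q d) (bound q d)))
      (≰⇒> (search-upper {Below q d} (below? q d) (bound q d) (<⇒≱ (bound-ok q d))))

  ⊔-shift : ∀ {p q δ} → 0ℚ < δ → p < q + δ → p ⊔ 0ℚ < q ⊔ 0ℚ + δ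
  ⊔-shift {p} {q} {δ} 0<δ lt with ≤-total p 0ℚ
  ... | inj₁ p≤0 = subst (_< q ⊔ 0ℚ + δ) (sym (p≤q⇒p⊔q≡q p≤0))
    (subst (0ℚ <_) (+-comm δ (q ⊔ 0ℚ)) (0<-+-0≤ {δ} {q ⊔ 0ℚ} 0<δ (p≤q⊔p q 0ℚ)))
  ... | inj₂ p≥0 = subst (_< q ⊔ 0ℚ + δ) (sym (p≥q⇒p⊔q≡p p≥0))
    (<-≤-trans lt (+-monoˡ-≤ δ (p≤p⊔q q 0ℚ)))

  roots-close : ∀ {p q s t u h} → 0ℚ < h → 0ℚ ≤ u → u ≤ h → 0ℚ ≤ t →
                square s ≤ p → p < q + h * h → q < square (t + u) → s - t < h + h
  roots-close {p} {q} {s} {t} {u} {h} 0<h 0≤u u≤h 0≤t s²≤p p<q+h² q<[t+u]² =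
    ≰⇒> λ le → <-irrefl refl (begin-strict
    square (t + h) + h * h
      ≤⟨ +-monoʳ-≤ (square (t + h)) (≤-trans (≤-reflexive (sym (+-identityʳ (h * h))))
           (+-monoʳ-≤ (h * h) extra)) ⟩
    square (t + h) + (h * h + (t * (h + h) + (h * h + h * h)))
      ≡⟨ solve 2 (λ t h → (t :+ h) :* (t :+ h) :+ (h :* h :+ (t :* (h :+ h) :+ (h :* h :+ h :* h)))
           := (t :+ (h :+ h)) :* (t :+ (h :+ h))) refl t h ⟩
    square (t + (h + h))
      ≤⟨ *-mono-≤-0≤ {t + (h + h)} {s} {t + (h + h)} {s} 0≤t+2h 0≤t+2h (t+2h≤s le) (t+2h≤s le) ⟩
    square s               ≤⟨ s²≤p ⟩
    p                      <⟨ p<q+h² ⟩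
    q + h * h              <⟨ +-monoˡ-< (h * h) q<[t+u]² ⟩
    square (t + u) + h * h ≤⟨ +-monoˡ-≤ (h * h) (*-mono-≤-0≤ {t + u} {t + h} {t + u} {t + h}
                                (0≤-+-0≤ {t} {u} 0≤t 0≤u) (0≤-+-0≤ {t} {u} 0≤t 0≤u)
                                (+-monoʳ-≤ t u≤h) (+-monoʳ-≤ t u≤h)) ⟩
    square (t + h) + h * h ∎)
    where
    open ≤-Reasoning
    0≤h : 0ℚ ≤ h
    0≤h = <⇒≤ 0<h
    0≤t+2h : 0ℚ ≤ t + (h + h)
    0≤t+2h = 0≤-+-0≤ {t} {h + h} 0≤t (0≤-+-0≤ {h} {h} 0≤h 0≤h)
    0≤h² : 0ℚ ≤ h * h
    0≤h² = 0≤-*-0≤ {h} {h} 0≤h 0≤h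
    extra : 0ℚ ≤ t * (h + h) + (h * h + h * h)
    extra = 0≤-+-0≤ {t * (h + h)} {h * h + h * h}
      (0≤-*-0≤ {t} {h + h} 0≤t (0≤-+-0≤ {h} {h} 0≤h 0≤h))
      (0≤-+-0≤ {h * h} {h * h} 0≤h² 0≤h²)
    t+2h≤s : h + h ≤ s - t → t + (h + h) ≤ s
    t+2h≤s le = subst (t + (h + h) ≤_) (solve 2 (λ s t → t :+ (s :- t) := s) refl s t)
      (+-monoʳ-≤ t le)

  approx-close : ∀ {p q d e h} → 0ℚ < h → step e ≤ h → 0ℚ ≤ p → p < q + h * h →
                 approx p d - approx q e < h + h
  approx-close {p} {q} {d} {e} {h} 0<h e≤h 0≤p lt =
    roots-close {p} {q} {approx p d} {approx q e} {step e} {h} 0<h (<⇒≤ (0<step e)) e≤h (0≤approx q e)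
      (approx-lower p d 0≤p) lt (approx-upper q e)

  √-seq : ℝ → ℕ → ℚ
  √-seq x n = approx (seq x n ⊔ 0ℚ) n

  √-cauchy : ∀ x → IsCauchy (√-seq x)
  √-cauchy x ε 0<ε = N ℕ.⊔ M , λ m n m≥ n≥ →
    ∣-∣-< (side m n m≥ n≥)
      (subst (_< ε) (sym (neg-sub (√-seq x m) (√-seq x n))) (side n m n≥ m≥))
    where
    h : ℚ
    h = half ε
    0<h : 0ℚ < h
    0<h = 0<half 0<ε
    N M : ℕ
    N = proj₁ (cauchy x (h * h) (0<-*-0< {h} {h} 0<h 0<h))
    M = proj₁ (archimedean h 0<h)
    side : ∀ m n → N ℕ.⊔ M ℕ.≤ m → N ℕ.⊔ M ℕ.≤ n → √-seq x m - √-seq x n < ε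
    side m n m≥ n≥ = subst (√-seq x m - √-seq x n <_) (half-sum ε)
      (approx-close {p⁺} {q⁺} {m} {n} {h} 0<h
        (≤-trans (step-mono {M} {n} (ℕP.m⊔n≤o⇒n≤o N M n≥)) (proj₂ (archimedean h 0<h)))
        (p≤q⊔p p 0ℚ)
        (⊔-shift {p} {q} {h * h} (0<-*-0< {h} {h} 0<h 0<h) (p-q<r⇒p<q+r {p} {q} {h * h} p-q<h²)))
      where
      p q p⁺ q⁺ : ℚ
      p = seq x m
      q = seq x n
      p⁺ = p ⊔ 0ℚ
      q⁺ = q ⊔ 0ℚ
      p-q<h² : p - q < h * h
      p-q<h² = ≤-<-trans (p≤∣p∣ (p - q)) (proj₂ (cauchy x (h * h) (0<-*-0< {h} {h} 0<h 0<h)) m n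
        (ℕP.m⊔n≤o⇒m≤o N M m≥) (ℕP.m⊔n≤o⇒m≤o N M n≥))

  -- The sequence √-seq x truncates negative terms to 0, so √ x is the usual
  -- square root for 0 ≤ x and is 0 for x ≤ 0.
  √ : ℝ → ℝ
  √ x = mkℝ (√-seq x) (√-cauchy x)

  root-large : ∀ {ε μ q s u} → 0ℚ < μ → μ ≤ ε → μ ≤ 1ℚ → 0ℚ ≤ s → 0ℚ ≤ u → u ≤ half μ →
               ε ≤ q → q < square (s + u) → half μ ≤ s
  root-large {ε} {μ} {q} {s} {u} 0<μ μ≤ε μ≤1 0≤s 0≤u u≤μ/2 ε≤q q<[s+u]² =
    ≮⇒≥ λ lt → <-irrefl refl (begin-strict
    ε                         ≤⟨ ε≤q ⟩
    q                         <⟨ q<[s+u]² ⟩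
    square (s + u)            <⟨ square-< {s + u} {half μ + half μ} (0≤-+-0≤ {s} {u} 0≤s 0≤u)
                                   (+-mono-<-≤ lt u≤μ/2) ⟩
    square (half μ + half μ)  ≡⟨ cong square (half-sum μ) ⟩
    square μ                  ≤⟨ *-mono-≤-0≤ {μ} {ε} {μ} {1ℚ} (<⇒≤ 0<μ) (<⇒≤ 0<μ) μ≤ε μ≤1 ⟩
    ε * 1ℚ                    ≡⟨ *-identityʳ ε ⟩
    ε                         ∎)
    where open ≤-Reasoning

  √-pos : ∀ x → 0ᴿ <ᴿ x → 0ᴿ <ᴿ √ x
  √-pos x (ε , 0<ε , N , h) = half μ , 0<half 0<μ , N ℕ.⊔ M , λ n n≥ →
    subst (_≤ √-seq x n) (sym (+-identityˡ (half μ))) (large n n≥)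
    where
    μ : ℚ
    μ = ε ⊓ 1ℚ
    0<μ : 0ℚ < μ
    0<μ = 0<⊓ 0<ε 0<1
    M : ℕ
    M = proj₁ (archimedean (half μ) (0<half 0<μ))
    large : ∀ n → N ℕ.⊔ M ℕ.≤ n → half μ ≤ √-seq x n
    large n n≥ = root-large {ε} {μ} {q} {√-seq x n} {step n} 0<μ (p⊓q≤p ε 1ℚ) (p⊓q≤q ε 1ℚ)
      (0≤approx q n) (<⇒≤ (0<step n))
      (≤-trans (step-mono {M} {n} (ℕP.m⊔n≤o⇒n≤o N M n≥)) (proj₂ (archimedean (half μ) (0<half 0<μ))))
      (≤-trans (subst (_≤ seq x n) (+-identityˡ ε) (h n (ℕP.m⊔n≤o⇒m≤o N M n≥)))
        (p≤p⊔q (seq x n) 0ℚ))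
      (approx-upper q n)
      where
      q : ℚ
      q = seq x n ⊔ 0ℚ

open SquareRoot public using (√; √-pos)

*ᴿ-pos : ∀ x y → 0ᴿ <ᴿ x → 0ᴿ <ᴿ y → 0ᴿ <ᴿ x *ᴿ y
*ᴿ-pos x y (ε , 0<ε , N , h) (δ , 0<δ , M , k) =
  ε * δ , 0<-*-0< 0<ε 0<δ , N ℕ.⊔ M , λ n n≥ →
    subst (_≤ seq x n * seq y n) (sym (+-identityˡ (ε * δ)))
      (*-mono-≤-0≤ (<⇒≤ 0<ε) (<⇒≤ 0<δ)
        (subst (_≤ seq x n) (+-identityˡ ε) (h n (ℕP.m⊔n≤o⇒m≤o N M n≥)))
        (subst (_≤ seq y n) (+-identityˡ δ) (k n (ℕP.m⊔n≤o⇒n≤o N M n≥))))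

^ᴿ-pos : ∀ x n → 0ᴿ <ᴿ x → 0ᴿ <ᴿ x ^ᴿ n
^ᴿ-pos x zero    0<x = 1ℚ , 0<1 , 0 , λ _ _ → ≤-reflexive (+-identityˡ 1ℚ)
^ᴿ-pos x (suc n) 0<x = *ᴿ-pos x (x ^ᴿ n) 0<x (^ᴿ-pos x n 0<x)

1<⇒pos : ∀ x → 1ᴿ <ᴿ x → 0ᴿ <ᴿ x
1<⇒pos x (ε , 0<ε , N , h) =
  ε , 0<ε , N , λ n n≥ → ≤-trans (+-monoˡ-≤ ε (<⇒≤ 0<1)) (h n n≥)

-- x ^ (m / 2)
_^½_ : ℝ → ℕ → ℝ
x ^½ m = √ (x ^ᴿ m)

^½-pos : ∀ x m → 1ᴿ <ᴿ x → 0ᴿ <ᴿ x ^½ m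
^½-pos x m 1<x = √-pos (x ^ᴿ m) (^ᴿ-pos x m (1<⇒pos x 1<x))

-- The ceiling is a relation because it is not computable; classically every
-- real has exactly one.
IsCeiling : ℝ → ℤ → Set
IsCeiling y m = y ≤ᴿ ℤ→ℝ m × (∀ j → y ≤ᴿ ℤ→ℝ j → m ℤ.≤ j)

cubic : (a b c : ℕ) → ℝ → ℝ
cubic a b c x = x ^ᴿ 3 -ᴿ ℕ→ℝ a *ᴿ x ^ᴿ 2 -ᴿ ℕ→ℝ b *ᴿ x -ᴿ ℕ→ℝ c

IsOnlyRoot : (ℝ → ℝ) → ℝ → Set
IsOnlyRoot f η = f η ≈ᴿ 0ᴿ × (∀ x → f x ≈ᴿ 0ᴿ → x ≈ᴿ η)

-- Positions are 0-based: the term x_i is at index i - 1. Positivity is required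
-- of the first three terms only.
record IsPositiveSolution (a b c n k : ℕ) (x : Vec ℤ k) : Set where
  field
    positive-start : ∀ (i : Fin k) → toℕ i ℕ.< 3 → ℤ.0ℤ ℤ.< lookup x i
    recurrence : ∀ (i₀ i₁ i₂ i₃ : Fin k) →
      toℕ i₁ ≡ 1 ℕ.+ toℕ i₀ → toℕ i₂ ≡ 2 ℕ.+ toℕ i₀ → toℕ i₃ ≡ 3 ℕ.+ toℕ i₀ →
      lookup x i₃ ≡ + a ℤ.* lookup x i₂ ℤ.+ + b ℤ.* lookup x i₁ ℤ.+ + c ℤ.* lookup x i₀
    terminates : ∀ (i : Fin k) → suc (toℕ i) ≡ k → lookup x i ≡ + n

-- Exactly N elements of A satisfy P; no N qualifies when infinitely many do.
HasCardinality : {A : Set} → (A → Set) → ℕ → Set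
HasCardinality {A} P N = ∃ λ (xs : List A) →
  Unique xs × (∀ x → x ∈ xs ⇔ P x) × length xs ≡ N

{-# OPTIONS --safe #-}
module Submission where

-- With c = 1 the polynomial is (x - η) (x² + s x + q), where ηq = 1, and the
-- quadratic factor is definite. Write a solution as its η-component plus a
-- residual x_{i+1} - η x_i, which satisfies the quadratic recurrence. Positivity
-- bounds the first three terms by O(n / η^k), hence the initial residuals; the
-- norm form of the quadratic factor shrinks by η^{-1} at each step, so the last
-- two residuals are O(n / η^{3k/2}). Since x_k = n is fixed, any two solutions
-- have x_{k-1}, and if these agree x_{k-2}, closer than m = ⌈T n / η^{3k/2}⌉, so that
-- (x_{k-1} mod m, x_{k-2} mod m) determines the solution and there are at most
-- m². Definiteness holds quantitatively because the discriminant of the cubic is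
-- a negative integer. When some starting term does not affect x_k, there are
-- either no solutions or infinitely many, and the bound is vacuous.

open import Defs
open import Algebra.Bundles using (CommutativeRing)
open import Algebra.Solver.Ring.AlmostCommutativeRing
  using (fromCommutativeRing; _-Raw-AlmostCommutative⟶_)
import Algebra.Solver.Ring
open import Data.Fin.Base as Fin using (Fin; toℕ; fromℕ<)
import Data.Fin.Properties as FinP
open import Data.Integer.Base as ℤ using (ℤ; +_; -[1+_])
import Data.Integer.Properties as ℤP
import Data.Integer.Solver as ℤSolver
open import Data.List.Base using (List; []; _∷_; length; lookup)
open import Data.List.Membership.Propositional using (_∈_)
open import Data.List.Membership.Propositional.Properties using (∈-lookup)
import Data.List.Relation.Unary.All as All
open import Data.List.Relation.Unary.AllPairs using (_∷_)
import Data.List.Relation.Unary.Any as Any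
open import Data.List.Relation.Unary.Any.Properties using (lookup-index)
open import Data.List.Relation.Unary.Unique.Propositional using (Unique)
open import Data.Maybe.Base using (Maybe; just; nothing)
open import Data.Nat.Base as ℕ using (ℕ; zero; suc)
import Data.Nat.DivMod as ℕD
import Data.Nat.Properties as ℕP
import Data.Nat.Solver as ℕSolver
open import Data.Product.Base using (_×_; _,_; proj₁; proj₂; ∃-syntax)
import Data.Rational.Solver as ℚSolver
open import Data.Sum.Base using (_⊎_; inj₁; inj₂)
open import Data.Vec.Base as Vec using (Vec; tabulate)
import Data.Vec.Properties as VecP
open import Function.Bundles using (Equivalence)
open import Level using (0ℓ)
open import Relation.Binary.Bundles using (Preorder)
import Relation.Binary.PropositionalEquality as ≡
open import Relation.Binary.Structures using (IsEquivalence)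
open import Relation.Nullary using (¬_; yes; no; contradiction)

-- Equality and order on `ℝ` are undecidable, and `≈ᴿ` is only a setoid equality. Case distinctions
-- therefore fall on integers or rationals, never on reals: the sign of `negDisc`, the sign of m,
-- whether a + b vanishes. The estimates are arranged to suit this. They bound squares instead of
-- absolute values, and they clear every division by h or by the half power. Each one then becomes
-- an integer polynomial identity, left to the ring solver, together with the nonnegativity of
-- visible terms; `OrderedRing` collects just what such certificates use. The uniqueness of the root
-- enters once, to make the integer `negDisc a b` positive. Being an integer it is then at least 1,
-- and this supplies the explicit lower bound that a mere positivity of Δ would not give.

-- The image of ℤ is kept explicit because ring identities are decided with
-- integer coefficients.
record OrderedRing : Set₁ where
  infix 4 _≼_
  field
    commutativeRing : CommutativeRing 0ℓ 0ℓ
  open CommutativeRing commutativeRing public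
  field
    _≼_           : Carrier → Carrier → Set
    ≼-reflexive   : ∀ {x y} → x ≈ y → x ≼ y
    ≼-trans       : ∀ {x y z} → x ≼ y → y ≼ z → x ≼ z
    +-mono-≼      : ∀ {x y u v} → x ≼ y → u ≼ v → x + u ≼ y + v
    ι             : ℤ → Carrier
    ι-+           : ∀ i j → ι (i ℤ.+ j) ≈ ι i + ι j
    ι-*           : ∀ i j → ι (i ℤ.* j) ≈ ι i * ι j
    ι-neg         : ∀ i → ι (ℤ.- i) ≈ - ι i
    ι-0           : ι (+ 0) ≈ 0#
    ι-1           : ι (+ 1) ≈ 1#
    ι-mono        : ∀ {i j} → i ℤ.≤ j → ι i ≼ ι j
    ι-cancel      : ∀ {i j} → ι i ≼ ι j → i ℤ.≤ j
    *-nonneg      : ∀ {x y} → ι (+ 0) ≼ x → ι (+ 0) ≼ y → ι (+ 0) ≼ x * y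
    square-nonneg : ∀ x → ι (+ 0) ≼ x * x
    -- Stands in for division by a positive element; the lower bound 1 keeps y uniformly away from
    -- 0.
    nonneg-cancel : ∀ {x y} → ι (+ 1) ≼ y → ι (+ 0) ≼ x * y → ι (+ 0) ≼ x
    -- Together with square roots, enough to solve a quadratic equation without a field structure.
    halving       : ∃[ x ] ι (+ 2) * x ≈ ι (+ 1)
    square-root   : ∀ x → ι (+ 0) ≼ x → ∃[ y ] ι (+ 0) ≼ y × y * y ≈ x

i≢0⇒1≤i² : ∀ {i} → i ≡.≢ + 0 → + 1 ℤ.≤ i ℤ.* i
i≢0⇒1≤i² {+ zero}   i≢0 = contradiction ≡.refl i≢0
i≢0⇒1≤i² {+ suc _}  _   = ℤ.+≤+ (ℕ.s≤s ℕ.z≤n)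
i≢0⇒1≤i² { -[1+ _ ]} _  = ℤ.+≤+ (ℕ.s≤s ℕ.z≤n)

-- Consequences of the ordered ring axioms.

module OrderedRingProperties (R : OrderedRing) where
  open OrderedRing R

  ι-morphism : ℤ.+-*-rawRing -Raw-AlmostCommutative⟶ fromCommutativeRing commutativeRing
  ι-morphism = record
    { ⟦_⟧ = ι ; +-homo = ι-+ ; *-homo = ι-* ; -‿homo = ι-neg ; 0-homo = ι-0 ; 1-homo = ι-1 }

  ι-≟ : ∀ i j → Maybe (ι i ≈ ι j)
  ι-≟ i j with i ℤP.≟ j
  ... | yes i≡j = just (reflexive (≡.cong ι i≡j))
  ... | no  _   = nothing

  open Algebra.Solver.Ring ℤ.+-*-rawRing (fromCommutativeRing commutativeRing) ι-morphism ι-≟ public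
    using (Polynomial; solve; con; _:+_; _:*_; _:-_; :-_; _:=_)

  preorder : Preorder 0ℓ 0ℓ 0ℓ
  preorder = record
    { isPreorder = record
      { isEquivalence = isEquivalence ; reflexive = ≼-reflexive ; trans = ≼-trans } }

  module ≼-Reasoning where
    open import Relation.Binary.Reasoning.Preorder preorder public

  𝟘 𝟙 𝟚 : Carrier
  𝟘 = ι (+ 0)
  𝟙 = ι (+ 1)
  𝟚 = ι (+ 2)

  :0 :1 :2 : ∀ {n} → Polynomial n
  :0 = con (+ 0)
  :1 = con (+ 1)
  :2 = con (+ 2)

  ≼-refl : ∀ {x} → x ≼ x
  ≼-refl = ≼-reflexive refl

  ≼-respʳ : ∀ {x y z} → y ≈ z → x ≼ y → x ≼ z
  ≼-respʳ y≈z x≼y = ≼-trans x≼y (≼-reflexive y≈z)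

  ≼-respˡ : ∀ {x y z} → x ≈ y → x ≼ z → y ≼ z
  ≼-respˡ x≈y x≼z = ≼-trans (≼-reflexive (sym x≈y)) x≼z

  *-idˡ : ∀ x → 𝟙 * x ≈ x
  *-idˡ x = trans (*-congʳ ι-1) (*-identityˡ x)

  0≼y-x⇒x≼y : ∀ {x y} → 𝟘 ≼ y - x → x ≼ y
  0≼y-x⇒x≼y {x} {y} h = ≼-respˡ (solve 1 (λ x → :0 :+ x := x) refl x)
    (≼-respʳ (solve 2 (λ x y → (y :- x) :+ x := y) refl x y) (+-mono-≼ h (≼-refl {x})))

  x≼y⇒0≼y-x : ∀ {x y} → x ≼ y → 𝟘 ≼ y - x
  x≼y⇒0≼y-x {x} {y} h =
    ≼-respˡ (solve 1 (λ x → x :- x := :0) refl x) (+-mono-≼ h (≼-refl { - x}))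

  -- The form in which polynomial inequalities are proved: the solver rewrites the difference as an
  -- expression whose nonnegativity can be read off.
  ≼-from-difference : ∀ {x y z} → y - x ≈ z → 𝟘 ≼ z → x ≼ y
  ≼-from-difference eq 0≼z = 0≼y-x⇒x≼y (≼-respʳ (sym eq) 0≼z)

  +-nonneg : ∀ {x y} → 𝟘 ≼ x → 𝟘 ≼ y → 𝟘 ≼ x + y
  +-nonneg 0≼x 0≼y = ≼-respˡ (solve 0 (:0 :+ :0 := :0) refl) (+-mono-≼ 0≼x 0≼y)

  ι-nonneg : ∀ n → 𝟘 ≼ ι (+ n)
  ι-nonneg n = ι-mono (ℤ.+≤+ ℕ.z≤n)

  *-monoʳ-≼ : ∀ {x y z} → 𝟘 ≼ z → x ≼ y → z * x ≼ z * y
  *-monoʳ-≼ {x} {y} {z} 0≼z x≼y = ≼-from-difference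
    (solve 3 (λ x y z → z :* y :- z :* x := z :* (y :- x)) refl x y z)
    (*-nonneg 0≼z (x≼y⇒0≼y-x x≼y))

  *-monoˡ-≼ : ∀ {x y z} → 𝟘 ≼ z → x ≼ y → x * z ≼ y * z
  *-monoˡ-≼ {x} {y} {z} 0≼z x≼y =
    ≼-respˡ (*-comm z x) (≼-respʳ (*-comm z y) (*-monoʳ-≼ 0≼z x≼y))

  ≼-scale : ∀ {x y} → 𝟙 ≼ x → 𝟘 ≼ y → y ≼ x * y
  ≼-scale {x} {y} 1≼x 0≼y = ≼-respˡ (*-idˡ y) (*-monoˡ-≼ 0≼y 1≼x)

  -- Two points of the interval from 0 to w differ by at most w. Squaring avoids the absolute value,
  -- and w² - (u - v)² splits into two nonnegative factors.
  square-difference-≼ : ∀ {u v w} → 𝟘 ≼ u → u ≼ w → 𝟘 ≼ v → v ≼ w → (u - v) * (u - v) ≼ w * w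
  square-difference-≼ {u} {v} {w} 0≼u u≼w 0≼v v≼w = ≼-from-difference
    (solve 3 (λ u v w → w :* w :- (u :- v) :* (u :- v) := ((w :- u) :+ v) :* ((w :- v) :+ u))
      refl u v w)
    (*-nonneg (+-nonneg (x≼y⇒0≼y-x u≼w) 0≼v) (+-nonneg (x≼y⇒0≼y-x v≼w) 0≼u))

  1⋠0 : ¬ 𝟙 ≼ 𝟘
  1⋠0 h with ι-cancel h
  ... | ℤ.+≤+ ()

  pow : Carrier → ℕ → Carrier
  pow x zero    = 𝟙
  pow x (suc n) = x * pow x n

  pow-+ : ∀ x m n → pow x (m ℕ.+ n) ≈ pow x m * pow x n
  pow-+ x zero    n = sym (*-idˡ (pow x n))
  pow-+ x (suc m) n = trans (*-congˡ (pow-+ x m n)) (sym (*-assoc x (pow x m) (pow x n)))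

  -- Identifies a power function given by its recursion, such as `_^ᴿ_`, with `pow`, whose base case
  -- is a constant known to the solver.
  pow-unique : ∀ x (f : ℕ → Carrier) → f 0 ≈ 𝟙 → (∀ n → f (suc n) ≈ x * f n) → ∀ n → f n ≈ pow x n
  pow-unique x f f₀ fₛ zero    = f₀
  pow-unique x f f₀ fₛ (suc n) = trans (fₛ n) (*-congˡ (pow-unique x f f₀ fₛ n))

  pow-nonneg : ∀ {x} → 𝟘 ≼ x → ∀ n → 𝟘 ≼ pow x n
  pow-nonneg 0≼x zero    = ι-nonneg 1
  pow-nonneg 0≼x (suc n) = *-nonneg 0≼x (pow-nonneg 0≼x n)

  -- To be read with H = h^{3k}, S = h^{3k/2}, and `Tn≼mS` as m ≥ T n / S with the division cleared.
  -- The constant is T = 1 + C because (1 + C)² already exceeds C, so that no root of C is required.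
  module Threshold {C H S n : Carrier} {m : ℤ}
    (0≼C : 𝟘 ≼ C) (1≼n : 𝟙 ≼ n) (0≼S : 𝟘 ≼ S) (S²≈H : S * S ≈ H) (Tn≼mS : (𝟙 + C) * n ≼ ι m * S)
    where

    n≼mS : n ≼ ι m * S
    n≼mS = ≼-trans (≼-from-difference
      (solve 2 (λ C n → (:1 :+ C) :* n :- n := C :* n) refl C n) (*-nonneg 0≼C 0≼n)) Tn≼mS
      where
      0≼n : 𝟘 ≼ n
      0≼n = ≼-trans (ι-nonneg 1) 1≼n

    m>0 : + 0 ℤ.< m
    m>0 with + 0 ℤP.<? m
    ... | yes m>0 = m>0
    ... | no  m≯0 = contradiction
      (≼-trans 1≼n (≼-trans n≼mS (≼-respʳ (solve 1 (λ S → :0 :* S := :0) refl S)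
        (*-monoˡ-≼ 0≼S (ι-mono (ℤP.≮⇒≥ m≯0)))))) 1⋠0

    -- A nonzero integer t has t² ≥ 1, which would give (T n)² ≼ m² S² ≼ H (t m)² ≼ C n².
    multiple≡0 : ∀ t → H * (ι (t ℤ.* m) * ι (t ℤ.* m)) ≼ C * (n * n) → t ≡.≡ + 0
    multiple≡0 t Hd²≼ with t ℤP.≟ + 0
    ... | yes t≡0 = t≡0
    ... | no  t≢0 = contradiction 1≼0 1⋠0
      where
      0≼n : 𝟘 ≼ n
      0≼n = ≼-trans (ι-nonneg 1) 1≼n

      0≼Tn : 𝟘 ≼ (𝟙 + C) * n
      0≼Tn = *-nonneg (+-nonneg (ι-nonneg 1) 0≼C) 0≼n

      [1+C]²n²≼Cn² : (𝟙 + C) * n * ((𝟙 + C) * n) ≼ C * (n * n)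
      [1+C]²n²≼Cn² = begin
        (𝟙 + C) * n * ((𝟙 + C) * n) ≲⟨ *-monoʳ-≼ 0≼Tn Tn≼mS ⟩
        (𝟙 + C) * n * (ι m * S)     ≲⟨ *-monoˡ-≼ (≼-trans 0≼Tn Tn≼mS) Tn≼mS ⟩
        ι m * S * (ι m * S)
          ≈⟨ solve 2 (λ m S → m :* S :* (m :* S) := (m :* m) :* (S :* S)) refl (ι m) S ⟩
        ι m * ι m * (S * S)         ≲⟨ ≼-scale (ι-mono (i≢0⇒1≤i² t≢0)) (*-nonneg (square-nonneg (ι m)) (square-nonneg S)) ⟩
        ι (t ℤ.* t) * (ι m * ι m * (S * S))
          ≈⟨ *-cong (ι-* t t) (*-congˡ S²≈H) ⟩
        ι t * ι t * (ι m * ι m * H)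
          ≈⟨ solve 3 (λ t m H → t :* t :* (m :* m :* H) := H :* (t :* m :* (t :* m))) refl (ι t) (ι m) H ⟩
        H * (ι t * ι m * (ι t * ι m))
          ≈⟨ *-congˡ (*-cong (ι-* t m) (ι-* t m)) ⟨
        H * (ι (t ℤ.* m) * ι (t ℤ.* m)) ≲⟨ Hd²≼ ⟩
        C * (n * n) ∎
        where open ≼-Reasoning

      1≼0 : 𝟙 ≼ 𝟘
      -- Discarding the multiples of C in (1 + C)² n² ≼ C n² leaves n² ≼ 0, whereas 1 ≼ n ≼ n².
      1≼0 = ≼-trans 1≼n (≼-trans (≼-scale 1≼n 0≼n) (≼-from-difference
        (solve 2 (λ C n → :0 :- n :* n :=
          (C :* (n :* n) :- (:1 :+ C) :* n :* ((:1 :+ C) :* n)) :+ C :* (n :* n) :+ C :* C :* (n :* n))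
          refl C n)
        (+-nonneg (+-nonneg (x≼y⇒0≼y-x [1+C]²n²≼Cn²) (*-nonneg 0≼C (square-nonneg n)))
          (*-nonneg (*-nonneg 0≼C 0≼C) (square-nonneg n)))))

-- The cubic, its quadratic cofactor and the discriminant.

-- Minus the discriminant of x³ - a x² - b x - 1.
negDisc : ℕ → ℕ → ℤ
negDisc a b = + 4 ℤ.* + a ℤ.* + a ℤ.* + a ℤ.+ + 18 ℤ.* + a ℤ.* + b ℤ.+ + 27
  ℤ.- + a ℤ.* + a ℤ.* + b ℤ.* + b ℤ.- + 4 ℤ.* + b ℤ.* + b ℤ.* + b

module Cubic (R : OrderedRing) (a b : ℕ) (h : OrderedRing.Carrier R) where
  open OrderedRing R
  open OrderedRingProperties R

  A B s q F Δ : Carrier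
  A = ι (+ a)
  B = ι (+ b)
  -- x³ - a x² - b x - hq = (x - h) (x² + s x + q), and Δ is minus the
  -- discriminant of the quadratic factor.
  s = h - A
  q = h * h - A * h - B
  F = ι (+ 3) * h * h - 𝟚 * A * h - B
  Δ = ι (+ 4) * q - s * s

  -- The discriminant of a cubic is the square of the derivative at a root
  -- times the discriminant of the cofactor.
  Δ-identity : h * q ≈ 𝟙 → Δ * (F * F) ≈ ι (negDisc a b)
  Δ-identity hq≈1 = begin
    Δ * (F * F)
      -- The identity holds for any constant term c = h q; that c is 1 enters only in the next step.
      ≈⟨ solve 3 (λ A B h →
           let s = h :- A
               q = h :* h :- A :* h :- B
               F = con (+ 3) :* h :* h :- :2 :* A :* h :- B
               c = h :* q
           in (con (+ 4) :* q :- s :* s) :* (F :* F) :=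
              con (+ 4) :* A :* A :* A :* c :+ con (+ 18) :* A :* B :* c :+ con (+ 27) :* (c :* c)
              :- A :* A :* B :* B :- con (+ 4) :* B :* B :* B) refl A B h ⟩
    ι (+ 4) * A * A * A * (h * q) + ι (+ 18) * A * B * (h * q) + ι (+ 27) * ((h * q) * (h * q))
      - A * A * B * B - ι (+ 4) * B * B * B
      ≈⟨ +-congʳ (+-congʳ (+-cong (+-cong (*-congˡ hq≈1) (*-congˡ hq≈1))
           (*-congˡ (*-cong hq≈1 hq≈1)))) ⟩
    ι (+ 4) * A * A * A * 𝟙 + ι (+ 18) * A * B * 𝟙 + ι (+ 27) * (𝟙 * 𝟙)
      - A * A * B * B - ι (+ 4) * B * B * B
      ≈⟨ solve 2 (λ A B →
           con (+ 4) :* A :* A :* A :* :1 :+ con (+ 18) :* A :* B :* :1 :+ con (+ 27) :* (:1 :* :1)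
              :- A :* A :* B :* B :- con (+ 4) :* B :* B :* B :=
           con (+ 4) :* A :* A :* A :+ con (+ 18) :* A :* B :+ con (+ 27)
              :- A :* A :* B :* B :- con (+ 4) :* B :* B :* B) refl A B ⟩
    ι (+ 4) * A * A * A + ι (+ 18) * A * B + ι (+ 27) - A * A * B * B - ι (+ 4) * B * B * B
      ≈⟨ sub (sub (trans (ι-+ _ _) (+-congʳ (trans (ι-+ _ _) (+-cong
           (mul (mul (ι-* _ _))) (mul (ι-* _ _)))))) (mul (mul (ι-* _ _)))) (mul (mul (ι-* _ _))) ⟨
    ι (negDisc a b) ∎
    where
    open import Relation.Binary.Reasoning.Setoid setoid
    mul : ∀ {i j x} → ι i ≈ x → ι (i ℤ.* j) ≈ x * ι j
    mul {i} {j} eq = trans (ι-* i j) (*-congʳ eq)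
    sub : ∀ {i j x y} → ι i ≈ x → ι j ≈ y → ι (i ℤ.- j) ≈ x - y
    sub {i} {j} i≈x j≈y = trans (ι-+ i (ℤ.- j)) (+-cong i≈x (trans (ι-neg j) (-‿cong j≈y)))

  value : Carrier → Carrier
  value x = x * x * x - A * (x * x) - B * x - 𝟙

  -- Horner's scheme at h produces the coefficients 1, s, q and the remainder h q - 1, so `value h`
  -- is h q - 1 identically.
  root⇒hq≈1 : value h ≈ 𝟘 → h * q ≈ 𝟙
  root⇒hq≈1 root = trans
    (solve 3 (λ A B h → h :* (h :* h :- A :* h :- B) :=
      (h :* h :* h :- A :* (h :* h) :- B :* h :- :1) :+ :1) refl A B h)
    (trans (+-congʳ root) (solve 0 (:0 :+ :1 := :1) refl))

  module Root (hq≈1 : h * q ≈ 𝟙) (1≼h : 𝟙 ≼ h) where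

    0≼h : 𝟘 ≼ h
    0≼h = ≼-trans (ι-nonneg 1) 1≼h

    -- As q is the inverse of h, inserting the factor h q replaces every division by h.
    cancel-hq : ∀ x → (h * q) * x ≈ x
    cancel-hq x = trans (*-congʳ hq≈1) (*-idˡ x)

    0≼q : 𝟘 ≼ q
    0≼q = ≼-respʳ (trans (solve 2 (λ h q → (q :* q) :* h := (h :* q) :* q) refl h q) (cancel-hq q))
      (*-nonneg (square-nonneg q) 0≼h)

    -- From h s = b + q, multiplied by q.
    0≼s : 𝟘 ≼ s
    0≼s = ≼-respʳ
      (trans (solve 3 (λ A B h → let q = h :* h :- A :* h :- B in q :* (B :+ q) := (h :* q) :* (h :- A))
        refl A B h) (cancel-hq s))
      (*-nonneg 0≼q (+-nonneg (ι-nonneg b) 0≼q))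

    q≼1 : q ≼ 𝟙
    q≼1 = ≼-respʳ hq≈1 (≼-scale 1≼h 0≼q)

    h≼1+Ah+B : h ≼ 𝟙 + A * h + B
    h≼1+Ah+B = ≼-trans (≼-scale 1≼h 0≼h) (≼-respˡ
      (solve 3 (λ A B h → (h :* h :- A :* h :- B) :+ A :* h :+ B := h :* h) refl A B h)
      (+-mono-≼ (+-mono-≼ q≼1 ≼-refl) ≼-refl))

    -- With a = b = 0 the preceding estimate reads h ≼ 1. This excludes the periodic recurrence
    -- x_{i+3} = x_i.
    h≰1⇒1≤a+b : ¬ h ≼ 𝟙 → 1 ℕ.≤ a ℕ.+ b
    h≰1⇒1≤a+b h⋠1 with 1 ℕP.≤? a ℕ.+ b
    ... | yes 1≤a+b = 1≤a+b
    ... | no  1≰a+b = contradiction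
      (≼-respʳ (trans (+-cong (+-congˡ (*-congʳ (ι≈0 a (ℕP.m+n≡0⇒m≡0 a a+b≡0)))) (ι≈0 b (ℕP.m+n≡0⇒n≡0 a a+b≡0)))
        (solve 1 (λ h → :1 :+ :0 :* h :+ :0 := :1) refl h)) h≼1+Ah+B) h⋠1
      where
      a+b≡0 : a ℕ.+ b ≡.≡ 0
      a+b≡0 = ℕP.n<1⇒n≡0 (ℕP.≰⇒> 1≰a+b)
      ι≈0 : ∀ n → n ≡.≡ 0 → ι (+ n) ≈ 𝟘
      ι≈0 n n≡0 = reflexive (≡.cong (λ n → ι (+ n)) n≡0)

    -- A quantitative form of h being a simple root: h F = a h² + 2 b h + 3, where F is the
    -- derivative of the cubic at h.
    1≼[hF]² : 𝟙 ≼ (h * F) * (h * F)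
    1≼[hF]² = ≼-trans 1≼hF (≼-scale 1≼hF (≼-trans (ι-nonneg 1) 1≼hF))
      where
      1≼hF : 𝟙 ≼ h * F
      1≼hF = ≼-from-difference
        (trans (+-congˡ (-‿cong (sym hq≈1)))
          (trans (solve 3 (λ A B h → let q = h :* h :- A :* h :- B in
              h :* (con (+ 3) :* h :* h :- :2 :* A :* h :- B) :- h :* q :=
              A :* (h :* h) :+ :2 :* B :* h :+ :2 :* (h :* q)) refl A B h)
            (+-congˡ (*-congˡ hq≈1))))
        (+-nonneg (+-nonneg
          (*-nonneg (ι-nonneg a) (*-nonneg 0≼h 0≼h))
          (*-nonneg (*-nonneg (ι-nonneg 2) (ι-nonneg b)) 0≼h))
          (*-nonneg (ι-nonneg 2) (ι-nonneg 1)))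

    -- By `Δ-identity`, -Δ (h F)² is -h² times the integer `negDisc a b`, and the factor (h F)² may
    -- be cancelled because it is at least 1.
    negDisc≤0⇒0≼-Δ : negDisc a b ℤ.≤ + 0 → 𝟘 ≼ - Δ
    negDisc≤0⇒0≼-Δ κ≤0 = nonneg-cancel 1≼[hF]² (≼-respʳ
      (trans (*-congˡ (-‿cong (sym (Δ-identity hq≈1))))
        (solve 3 (λ h F Δ → (h :* h) :* (:- (Δ :* (F :* F))) := :- Δ :* ((h :* F) :* (h :* F)))
          refl h F Δ))
      (*-nonneg (*-nonneg 0≼h 0≼h)
        (≼-respʳ (solve 1 (λ κ → :0 :- κ := :- κ) refl (ι (negDisc a b))) (x≼y⇒0≼y-x (ι-mono κ≤0)))))

    -- If -Δ were nonnegative, the quadratic factor would have the root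
    -- (-s - √(-Δ)) / 2, which is not positive.
    only-root⇒negDisc>0 : (∀ x → value x ≈ 𝟘 → x ≈ h) → + 1 ℤ.≤ negDisc a b
    only-root⇒negDisc>0 only with + 0 ℤP.<? negDisc a b
    ... | yes κ>0 = ℤP.i<j⇒suc[i]≤j κ>0
    ... | no  κ≯0 = contradiction (second-root halving (square-root (- Δ) (negDisc≤0⇒0≼-Δ κ≤0))) 1⋠0
      where
      κ≤0 : negDisc a b ℤ.≤ + 0
      κ≤0 = ℤP.≮⇒≥ κ≯0

      second-root : (∃[ t ] 𝟚 * t ≈ 𝟙) → (∃[ w ] 𝟘 ≼ w × w * w ≈ - Δ) → 𝟙 ≼ 𝟘
      second-root (t , 2t≈1) (w , 0≼w , w²≈-Δ) = ≼-trans 1≼h (≼-from-difference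
        (trans (+-congˡ (-‿cong (sym z≈h)))
          (solve 3 (λ s w t → :0 :- t :* (:- s :- w) := t :* (s :+ w)) refl s w t))
        (*-nonneg 0≼t (+-nonneg 0≼s 0≼w)))
        where
        0≼t : 𝟘 ≼ t
        0≼t = ≼-respʳ
          (trans (solve 1 (λ t → :2 :* (t :* t) := (:2 :* t) :* t) refl t)
            (trans (*-congʳ 2t≈1) (*-idˡ t)))
          (*-nonneg (ι-nonneg 2) (square-nonneg t))

        z : Carrier
        z = t * (- s - w)

        quadratic≈0 : z * z + s * z + q ≈ 𝟘
        quadratic≈0 = begin
          -- Completing the square, 4 (z² + s z + q) = (2 z + s)² + Δ, and 2 t = 1 turns 2 z + s
          -- into -w.
          z * z + s * z + q
            ≈⟨ trans (*-congʳ (trans (*-cong 2t≈1 2t≈1) (*-idˡ 𝟙))) (*-idˡ _) ⟨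
          (𝟚 * t) * (𝟚 * t) * (z * z + s * z + q)
            ≈⟨ solve 4 (λ s q w t → let z = t :* (:- s :- w) in
                 (:2 :* t) :* (:2 :* t) :* (z :* z :+ s :* z :+ q) :=
                 t :* t :* (((:2 :* t) :* (:- s :- w) :+ s) :* ((:2 :* t) :* (:- s :- w) :+ s)
                   :+ (con (+ 4) :* q :- s :* s))) refl s q w t ⟩
          t * t * (((𝟚 * t) * (- s - w) + s) * ((𝟚 * t) * (- s - w) + s) + Δ)
            ≈⟨ *-congˡ (+-congʳ (*-cong (+-congʳ (*-congʳ 2t≈1)) (+-congʳ (*-congʳ 2t≈1)))) ⟩
          t * t * ((𝟙 * (- s - w) + s) * (𝟙 * (- s - w) + s) + Δ)
            ≈⟨ solve 4 (λ s w t Δ →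
                 t :* t :* ((:1 :* (:- s :- w) :+ s) :* (:1 :* (:- s :- w) :+ s) :+ Δ) :=
                 t :* t :* (w :* w :+ Δ)) refl s w t Δ ⟩
          t * t * (w * w + Δ)
            ≈⟨ *-congˡ (+-congʳ w²≈-Δ) ⟩
          t * t * (- Δ + Δ)
            ≈⟨ solve 2 (λ t Δ → t :* t :* (:- Δ :+ Δ) := :0) refl t Δ ⟩
          𝟘 ∎
          where open import Relation.Binary.Reasoning.Setoid setoid

        z≈h : z ≈ h
        z≈h = only z (begin
          value z
            ≈⟨ +-congˡ (-‿cong (sym hq≈1)) ⟩
          z * z * z - A * (z * z) - B * z - h * q
            ≈⟨ solve 4 (λ A B h z → let s = h :- A ; q = h :* h :- A :* h :- B in
                 z :* z :* z :- A :* (z :* z) :- B :* z :- h :* q :=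
                 (z :- h) :* (z :* z :+ s :* z :+ q)) refl A B h z ⟩
          (z - h) * (z * z + s * z + q)
            ≈⟨ *-congˡ quadratic≈0 ⟩
          (z - h) * 𝟘
            ≈⟨ solve 1 (λ x → x :* :0 := :0) refl (z - h) ⟩
          𝟘 ∎)
          where open import Relation.Binary.Reasoning.Setoid setoid

    -- Recurrent sequences: the dominant component and the residual.

    Recurrent : (ℕ → Carrier) → Set
    Recurrent x = ∀ i → x (3 ℕ.+ i) ≈ A * x (2 ℕ.+ i) + B * x (1 ℕ.+ i) + x i

    -- The left eigenvector of the recurrence for h; it annihilates the
    -- contribution of the other two roots.
    dominant : (ℕ → Carrier) → ℕ → Carrier
    dominant x i = x (2 ℕ.+ i) + s * x (1 ℕ.+ i) + q * x i

    dominant-suc : ∀ {x} → Recurrent x → ∀ i → dominant x (suc i) ≈ h * dominant x i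
    dominant-suc {x} rec i = begin
      dominant x (suc i)
        ≈⟨ +-congʳ (+-congʳ (trans (rec i) (+-congˡ (sym (cancel-hq (x i)))))) ⟩
      (A * x (2 ℕ.+ i) + B * x (1 ℕ.+ i) + (h * q) * x i) + s * x (2 ℕ.+ i) + q * x (1 ℕ.+ i)
        ≈⟨ solve 6 (λ A B h x₂ x₁ x₀ → let s = h :- A ; q = h :* h :- A :* h :- B in
             (A :* x₂ :+ B :* x₁ :+ (h :* q) :* x₀) :+ s :* x₂ :+ q :* x₁ :=
             h :* (x₂ :+ s :* x₁ :+ q :* x₀)) refl A B h (x (2 ℕ.+ i)) (x (1 ℕ.+ i)) (x i) ⟩
      h * dominant x i ∎
      where open import Relation.Binary.Reasoning.Setoid setoid

    dominant-pow : ∀ {x} → Recurrent x → ∀ j → dominant x j ≈ pow h j * dominant x 0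
    dominant-pow rec zero    = sym (*-idˡ _)
    dominant-pow rec (suc j) =
      trans (dominant-suc rec j) (trans (*-congˡ (dominant-pow rec j)) (sym (*-assoc h _ _)))

    residual : (ℕ → Carrier) → ℕ → Carrier
    residual d i = d (1 ℕ.+ i) - h * d i

    residual-suc : ∀ {d} → Recurrent d → ∀ i →
      residual d (2 ℕ.+ i) ≈ - (s * residual d (1 ℕ.+ i)) - q * residual d i
    residual-suc {d} rec i = begin
      residual d (2 ℕ.+ i)
        ≈⟨ +-congʳ (trans (rec i) (+-congˡ (sym (cancel-hq (d i))))) ⟩
      (A * d (2 ℕ.+ i) + B * d (1 ℕ.+ i) + (h * q) * d i) - h * d (2 ℕ.+ i)
        ≈⟨ solve 6 (λ A B h d₂ d₁ d₀ → let s = h :- A ; q = h :* h :- A :* h :- B in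
             (A :* d₂ :+ B :* d₁ :+ (h :* q) :* d₀) :- h :* d₂ :=
             :- (s :* (d₂ :- h :* d₁)) :- q :* (d₁ :- h :* d₀))
             refl A B h (d (2 ℕ.+ i)) (d (1 ℕ.+ i)) (d i) ⟩
      - (s * residual d (1 ℕ.+ i)) - q * residual d i ∎
      where open import Relation.Binary.Reasoning.Setoid setoid

    -- Twice the norm form of x² + s x + q.
    form : Carrier → Carrier → Carrier
    form u v = 𝟚 * (v * v + s * (u * v) + q * (u * u))

    form-cong : ∀ {u u′ v v′} → u ≈ u′ → v ≈ v′ → form u v ≈ form u′ v′
    form-cong u≈ v≈ = *-congˡ (+-cong (+-cong (*-cong v≈ v≈) (*-congˡ (*-cong u≈ v≈)))
      (*-congˡ (*-cong u≈ u≈)))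

    residualForm : (ℕ → Carrier) → ℕ → Carrier
    residualForm d i = form (residual d i) (residual d (1 ℕ.+ i))

    -- Up to the factor 2, the form is the product of e₁ - ρ e₀ over the two roots ρ of x² + s x +
    -- q. One step multiplies it by the product of these roots, which is q, the inverse of h.
    residualForm-suc : ∀ {d} → Recurrent d → ∀ i → h * residualForm d (suc i) ≈ residualForm d i
    residualForm-suc {d} rec i = begin
      h * residualForm d (suc i)
        ≈⟨ *-congˡ (form-cong refl (residual-suc rec i)) ⟩
      h * form e₁ (- (s * e₁) - q * e₀)
        ≈⟨ solve 5 (λ h s q e₀ e₁ → let e₂ = :- (s :* e₁) :- q :* e₀ in
             h :* (:2 :* (e₂ :* e₂ :+ s :* (e₁ :* e₂) :+ q :* (e₁ :* e₁))) :=
             (h :* q) :* (:2 :* (e₁ :* e₁ :+ s :* (e₀ :* e₁) :+ q :* (e₀ :* e₀))))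
             refl h s q e₀ e₁ ⟩
      (h * q) * form e₀ e₁
        ≈⟨ cancel-hq _ ⟩
      residualForm d i ∎
      where
      open import Relation.Binary.Reasoning.Setoid setoid
      e₀ e₁ : Carrier
      e₀ = residual d i
      e₁ = residual d (1 ℕ.+ i)

    residualForm-pow : ∀ {d} → Recurrent d → ∀ j →
      pow h j * residualForm d j ≈ residualForm d 0
    residualForm-pow rec zero    = *-idˡ _
    residualForm-pow {d} rec (suc j) = begin
      (h * pow h j) * residualForm d (suc j)
        ≈⟨ solve 3 (λ x y z → (x :* y) :* z := y :* (x :* z)) refl h (pow h j) _ ⟩
      pow h j * (h * residualForm d (suc j))
        ≈⟨ *-congˡ (residualForm-suc rec j) ⟩
      pow h j * residualForm d j
        ≈⟨ residualForm-pow rec j ⟩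
      residualForm d 0 ∎
      where open import Relation.Binary.Reasoning.Setoid setoid

    form-scale : ∀ c u v → c * c * form u v ≈ form (c * u) (c * v)
    form-scale c u v = solve 5 (λ s q c u v →
      c :* c :* (:2 :* (v :* v :+ s :* (u :* v) :+ q :* (u :* u))) :=
      :2 :* ((c :* v) :* (c :* v) :+ s :* ((c :* u) :* (c :* v)) :+ q :* ((c :* u) :* (c :* u))))
      refl s q c u v

    r : Carrier
    r = 𝟚 + 𝟚 * s + 𝟚 * q

    0≼r : 𝟘 ≼ r
    0≼r = +-nonneg (+-nonneg (ι-nonneg 2) (*-nonneg (ι-nonneg 2) 0≼s)) (*-nonneg (ι-nonneg 2) 0≼q)

    -- The factor 2 in `form` allows the cross term to be written as s (u² + v² - (u - v)²) without
    -- fractions.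
    form-≼ : ∀ {u v E} → u * u ≼ E → v * v ≼ E → form u v ≼ r * E
    form-≼ {u} {v} {E} u²≼E v²≼E = ≼-from-difference
      (solve 5 (λ s q u v E →
        (:2 :+ :2 :* s :+ :2 :* q) :* E :- :2 :* (v :* v :+ s :* (u :* v) :+ q :* (u :* u)) :=
        :2 :* (E :- v :* v) :+ s :* ((u :- v) :* (u :- v) :+ (E :- u :* u) :+ (E :- v :* v))
          :+ :2 :* q :* (E :- u :* u)) refl s q u v E)
      (+-nonneg (+-nonneg
        (*-nonneg (ι-nonneg 2) 0≼E-v²)
        (*-nonneg 0≼s (+-nonneg (+-nonneg (square-nonneg _) 0≼E-u²) 0≼E-v²)))
        (*-nonneg (*-nonneg (ι-nonneg 2) 0≼q) 0≼E-u²))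
      where
      0≼E-u² : 𝟘 ≼ E - u * u
      0≼E-u² = x≼y⇒0≼y-x u²≼E
      0≼E-v² : 𝟘 ≼ E - v * v
      0≼E-v² = x≼y⇒0≼y-x v²≼E

    -- With P = h^j and k = j + 3: c₁ n bounds P times each of the first three terms, c₂ n² bounds
    -- P² times the squares of the initial residuals, and c₃ n² bounds P³ times the squared
    -- differences near the end. The factor h⁹ converts P³ into h^{3k}. Only a, b and h occur, so T
    -- is independent of n and k.
    c₁ c₂ c₃ bound : Carrier
    c₁ = h * h * (𝟙 + ι (+ suc b) * (s + q))
    c₂ = (𝟚 + 𝟚 * (h * h)) * (c₁ * c₁)
    c₃ = 𝟚 * (F * F) * r * c₂
    bound = pow h 9 * c₃

    0≼bound : 𝟘 ≼ bound
    0≼bound = *-nonneg (pow-nonneg 0≼h 9) (*-nonneg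
      (*-nonneg (*-nonneg (ι-nonneg 2) (square-nonneg F)) 0≼r)
      (*-nonneg (+-nonneg (ι-nonneg 2) (*-nonneg (ι-nonneg 2) (*-nonneg 0≼h 0≼h))) (square-nonneg c₁)))

    -- Bounds from the definiteness of the quadratic factor.

    module Definite (1≼ΔF² : 𝟙 ≼ Δ * (F * F)) where

      -- Completing the square gives 4 (v² + s u v + q u²) = (2 v + s u)² + Δ u²; after
      -- multiplication by F² the coefficient of u² is at least 1.
      square≼formˡ : ∀ u v → u * u ≼ 𝟚 * (F * F) * form u v
      square≼formˡ u v = ≼-trans
        (≼-scale 1≼ΔF² (square-nonneg u))
        (≼-from-difference
          (solve 5 (λ s q F u v →
            :2 :* (F :* F) :* (:2 :* (v :* v :+ s :* (u :* v) :+ q :* (u :* u)))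
              :- (con (+ 4) :* q :- s :* s) :* (F :* F) :* (u :* u) :=
            (F :* (:2 :* v :+ s :* u)) :* (F :* (:2 :* v :+ s :* u))) refl s q F u v)
          (square-nonneg _))

      form-nonneg : ∀ u v → 𝟘 ≼ 𝟚 * (F * F) * form u v
      form-nonneg u v = ≼-trans (square-nonneg u) (square≼formˡ u v)

      -- Completing the square in the other variable costs a factor q on the side of the form, which
      -- is dropped because q ≼ 1.
      square≼formʳ : ∀ u v → v * v ≼ 𝟚 * (F * F) * form u v
      square≼formʳ u v = ≼-trans
        (≼-scale 1≼ΔF² (square-nonneg v))
        (≼-trans
          (≼-from-difference
            (solve 5 (λ s q F u v →
              q :* (:2 :* (F :* F) :* (:2 :* (v :* v :+ s :* (u :* v) :+ q :* (u :* u))))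
                :- (con (+ 4) :* q :- s :* s) :* (F :* F) :* (v :* v) :=
              (F :* (:2 :* q :* u :+ s :* v)) :* (F :* (:2 :* q :* u :+ s :* v))) refl s q F u v)
            (square-nonneg _))
          (≼-respʳ (*-idˡ _) (*-monoˡ-≼ (form-nonneg u v) q≼1)))

      record Start (x : ℕ → Carrier) : Set where
        field
          recurrent : Recurrent x
          x₀≥0      : 𝟘 ≼ x 0
          x₁≥0      : 𝟘 ≼ x 1
          x₂≥0      : 𝟘 ≼ x 2

        dominant-nonneg : 𝟘 ≼ dominant x 0
        dominant-nonneg = +-nonneg (+-nonneg x₂≥0 (*-nonneg 0≼s x₁≥0)) (*-nonneg 0≼q x₀≥0)

        1≼h² : 𝟙 ≼ h * h
        1≼h² = ≼-trans 1≼h (≼-scale 1≼h 0≼h)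

        -- All summands of `dominant` are nonnegative and each of its coefficients 1, s, q is at
        -- least h⁻²; here q = h⁻¹.
        x₀≼ : x 0 ≼ h * h * dominant x 0
        x₀≼ = ≼-trans
          (≼-from-difference {y = h * dominant x 0}
            (trans (+-congˡ (-‿cong (sym (cancel-hq (x 0)))))
              (solve 6 (λ h s q x₀ x₁ x₂ →
                h :* (x₂ :+ s :* x₁ :+ q :* x₀) :- (h :* q) :* x₀ := h :* (x₂ :+ s :* x₁))
                refl h s q (x 0) (x 1) (x 2)))
            (*-nonneg 0≼h (+-nonneg x₂≥0 (*-nonneg 0≼s x₁≥0))))
          (≼-respʳ (sym (*-assoc h h _)) (≼-scale 1≼h (*-nonneg 0≼h dominant-nonneg)))

        -- h² s = b h + 1
        x₁≼ : x 1 ≼ h * h * dominant x 0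
        x₁≼ = ≼-from-difference
          (trans (+-congˡ (-‿cong (sym (cancel-hq (x 1)))))
            (solve 6 (λ A B h x₀ x₁ x₂ → let s = h :- A ; q = h :* h :- A :* h :- B in
              h :* h :* (x₂ :+ s :* x₁ :+ q :* x₀) :- (h :* q) :* x₁ :=
              h :* h :* x₂ :+ B :* h :* x₁ :+ h :* h :* (q :* x₀))
              refl A B h (x 0) (x 1) (x 2)))
          (+-nonneg (+-nonneg
            (*-nonneg (*-nonneg 0≼h 0≼h) x₂≥0)
            (*-nonneg (*-nonneg (ι-nonneg b) 0≼h) x₁≥0))
            (*-nonneg (*-nonneg 0≼h 0≼h) (*-nonneg 0≼q x₀≥0)))

        x₂≼ : x 2 ≼ h * h * dominant x 0
        x₂≼ = ≼-trans
          (≼-from-difference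
            (solve 5 (λ s q x₀ x₁ x₂ →
              (x₂ :+ s :* x₁ :+ q :* x₀) :- x₂ := s :* x₁ :+ q :* x₀) refl s q (x 0) (x 1) (x 2))
            (+-nonneg (*-nonneg 0≼s x₁≥0) (*-nonneg 0≼q x₀≥0)))
          (≼-scale 1≼h² dominant-nonneg)

      -- The factor b + 1 is there because for a = 0 the last term need not be the largest.
      record EndsAt (j : ℕ) (n : Carrier) (x : ℕ → Carrier) : Set where
        field
          start       : Start x
          last        : x (2 ℕ.+ j) ≈ n
          penultimate : x (1 ℕ.+ j) ≼ ι (+ suc b) * n
          third-last  : x j ≼ ι (+ suc b) * n
        open Start start public

        -- `dominant` grows by exactly h per step, so h^j times its initial value is its value at
        -- index j, which involves only the last three terms.
        c₁-bound : pow h j * (h * h * dominant x 0) ≼ c₁ * n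
        c₁-bound = ≼-respˡ
          (trans (*-congˡ (dominant-pow recurrent j))
            (solve 3 (λ h P D → (h :* h) :* (P :* D) := P :* (h :* h :* D))
              refl h (pow h j) (dominant x 0)))
          (≼-respʳ
            (solve 5 (λ h s q β n → (h :* h) :* (n :+ s :* (β :* n) :+ q :* (β :* n)) :=
              (h :* h) :* (:1 :+ β :* (s :+ q)) :* n) refl h s q (ι (+ suc b)) n)
            (*-monoʳ-≼ (*-nonneg 0≼h 0≼h)
              (+-mono-≼ (+-mono-≼ (≼-reflexive last) (*-monoʳ-≼ 0≼s penultimate))
                (*-monoʳ-≼ 0≼q third-last))))

        scaled : ∀ {y} → y ≼ h * h * dominant x 0 → pow h j * y ≼ c₁ * n
        scaled y≼ = ≼-trans (*-monoʳ-≼ (pow-nonneg 0≼h j) y≼) c₁-bound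

        scaled-nonneg : ∀ {y} → 𝟘 ≼ y → 𝟘 ≼ pow h j * y
        scaled-nonneg = *-nonneg (pow-nonneg 0≼h j)

      module Difference {j n x y} (X : EndsAt j n x) (Y : EndsAt j n y) where
        module X = EndsAt X
        module Y = EndsAt Y

        d : ℕ → Carrier
        d i = x i - y i

        P W : Carrier
        P = pow h j
        W = (c₁ * n) * (c₁ * n)

        recurrent : Recurrent d
        recurrent i = trans (+-cong (X.recurrent i) (-‿cong (Y.recurrent i)))
          (solve 8 (λ A B x₂ x₁ x₀ y₂ y₁ y₀ →
            (A :* x₂ :+ B :* x₁ :+ x₀) :- (A :* y₂ :+ B :* y₁ :+ y₀) :=
            A :* (x₂ :- y₂) :+ B :* (x₁ :- y₁) :+ (x₀ :- y₀)) refl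
            A B (x (2 ℕ.+ i)) (x (1 ℕ.+ i)) (x i) (y (2 ℕ.+ i)) (y (1 ℕ.+ i)) (y i))

        last≈0 : d (2 ℕ.+ j) ≈ 𝟘
        last≈0 = trans (+-cong X.last (-‿cong Y.last)) (solve 1 (λ n → n :- n := :0) refl n)

        d-bound : ∀ i → 𝟘 ≼ x i → x i ≼ h * h * dominant x 0 → 𝟘 ≼ y i → y i ≼ h * h * dominant y 0 →
          (P * d i) * (P * d i) ≼ W
        d-bound i 0≼x x≼ 0≼y y≼ = ≼-respˡ
          (solve 3 (λ P u v → (P :* u :- P :* v) :* (P :* u :- P :* v) :=
            (P :* (u :- v)) :* (P :* (u :- v))) refl P (x i) (y i))
          (square-difference-≼ (X.scaled-nonneg 0≼x) (X.scaled x≼) (Y.scaled-nonneg 0≼y) (Y.scaled y≼))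

        -- From (v - h u)² + (v + h u)² = 2 v² + 2 h² u².
        residual-bound : ∀ i → (P * d i) * (P * d i) ≼ W → (P * d (suc i)) * (P * d (suc i)) ≼ W →
          (P * residual d i) * (P * residual d i) ≼ c₂ * (n * n)
        residual-bound i d₀ d₁ = ≼-from-difference
          (solve 6 (λ P h u v c n →
            (:2 :+ :2 :* (h :* h)) :* (c :* c) :* (n :* n)
              :- (P :* (v :- h :* u)) :* (P :* (v :- h :* u)) :=
            :2 :* ((c :* n) :* (c :* n) :- (P :* v) :* (P :* v))
              :+ :2 :* (h :* h) :* ((c :* n) :* (c :* n) :- (P :* u) :* (P :* u))
              :+ (P :* (v :+ h :* u)) :* (P :* (v :+ h :* u))) refl P h (d i) (d (suc i)) c₁ n)
          (+-nonneg (+-nonneg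
            (*-nonneg (ι-nonneg 2) (x≼y⇒0≼y-x d₁))
            (*-nonneg (*-nonneg (ι-nonneg 2) (*-nonneg 0≼h 0≼h)) (x≼y⇒0≼y-x d₀)))
            (square-nonneg _))

        -- Origin of the exponent 3k/2: two factors P scale the initial residuals, the third undoes
        -- the decay of the form over j steps, and the result bounds a square.
        form-bound : P * P * P * residualForm d j ≼ r * (c₂ * (n * n))
        form-bound = ≼-respˡ
          (trans (sym (form-scale P (residual d 0) (residual d 1)))
            (trans (*-congˡ (sym (residualForm-pow recurrent j))) (sym (*-assoc (P * P) P _))))
          (form-≼ (residual-bound 0 d₀ d₁) (residual-bound 1 d₁ d₂))
          where
          d₀ : (P * d 0) * (P * d 0) ≼ W
          d₀ = d-bound 0 X.x₀≥0 X.x₀≼ Y.x₀≥0 Y.x₀≼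
          d₁ : (P * d 1) * (P * d 1) ≼ W
          d₁ = d-bound 1 X.x₁≥0 X.x₁≼ Y.x₁≥0 Y.x₁≼
          d₂ : (P * d 2) * (P * d 2) ≼ W
          d₂ = d-bound 2 X.x₂≥0 X.x₂≼ Y.x₂≥0 Y.x₂≼

        pow-3k : pow h (3 ℕ.* (3 ℕ.+ j)) ≈ pow h 9 * (P * P * P)
        pow-3k = trans (reflexive (≡.cong (pow h) (ℕP.*-distribˡ-+ 3 3 j)))
          (trans (pow-+ h 9 (3 ℕ.* j)) (*-congˡ
            (trans (pow-+ h j (j ℕ.+ (j ℕ.+ 0))) (trans (*-congˡ (trans (pow-+ h j (j ℕ.+ 0))
              (*-congˡ (reflexive (≡.cong (pow h) (ℕP.+-identityʳ j))))))
              (sym (*-assoc P P P))))))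

        -- Once the next difference vanishes, the residual is -h d_i, so a bound on the residual
        -- bounds the difference itself. It is applied to the penultimate terms first, and to the
        -- terms before them when those agree.
        end-bound : ∀ i → d (suc i) ≈ 𝟘 → residual d i * residual d i ≼ 𝟚 * (F * F) * residualForm d j →
          pow h (3 ℕ.* (3 ℕ.+ j)) * (d i * d i) ≼ bound * (n * n)
        end-bound i d≈0 e²≼ = begin
          pow h (3 ℕ.* (3 ℕ.+ j)) * (d i * d i)
            ≈⟨ *-congʳ pow-3k ⟩
          pow h 9 * (P * P * P) * (d i * d i)
            ≲⟨ *-monoʳ-≼ 0≼h⁹P³ (≼-trans (≼-scale 1≼h² (square-nonneg (d i)))
                 (≼-respˡ (trans (*-cong e≈ e≈) (solve 2 (λ h d → (:0 :- h :* d) :* (:0 :- h :* d) :=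
                   h :* h :* (d :* d)) refl h (d i))) e²≼)) ⟩
          pow h 9 * (P * P * P) * (𝟚 * (F * F) * residualForm d j)
            ≈⟨ solve 4 (λ H P F Q → H :* (P :* P :* P) :* (F :* Q) := H :* F :* (P :* P :* P :* Q))
                 refl (pow h 9) P (𝟚 * (F * F)) (residualForm d j) ⟩
          pow h 9 * (𝟚 * (F * F)) * (P * P * P * residualForm d j)
            ≲⟨ *-monoʳ-≼ (*-nonneg (pow-nonneg 0≼h 9) (*-nonneg (ι-nonneg 2) (square-nonneg F))) form-bound ⟩
          pow h 9 * (𝟚 * (F * F)) * (r * (c₂ * (n * n)))
            ≈⟨ solve 5 (λ H F r c n → H :* F :* (r :* (c :* n)) := H :* (F :* r :* c) :* n)
                 refl (pow h 9) (𝟚 * (F * F)) r c₂ (n * n) ⟩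
          bound * (n * n) ∎
          where
          open ≼-Reasoning
          e≈ : residual d i ≈ 𝟘 - h * d i
          e≈ = +-congʳ d≈0
          1≼h² : 𝟙 ≼ h * h
          1≼h² = X.1≼h²
          0≼P : 𝟘 ≼ P
          0≼P = pow-nonneg 0≼h j
          0≼h⁹P³ : 𝟘 ≼ pow h 9 * (P * P * P)
          0≼h⁹P³ = *-nonneg (pow-nonneg 0≼h 9) (*-nonneg (*-nonneg 0≼P 0≼P) 0≼P)

        penultimate-bound : pow h (3 ℕ.* (3 ℕ.+ j)) * (d (suc j) * d (suc j)) ≼ bound * (n * n)
        penultimate-bound = end-bound (suc j) last≈0 (square≼formʳ _ _)

        third-last-bound : d (suc j) ≈ 𝟘 →
          pow h (3 ℕ.* (3 ℕ.+ j)) * (d j * d j) ≼ bound * (n * n)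
        third-last-bound d≈0 = end-bound j d≈0 (square≼formˡ _ _)

open ≡ using (_≡_; refl; sym; trans; cong; cong₂; subst; module ≡-Reasoning)

-- Counting with duplicate-free lists.

module _ {A : Set} where

  lookup-injective : ∀ {xs : List A} → Unique xs → ∀ i j → lookup xs i ≡ lookup xs j → i ≡ j
  lookup-injective (_ ∷ _) Fin.zero Fin.zero _ = refl
  lookup-injective {_ ∷ xs} (x∉ ∷ _) Fin.zero (Fin.suc j) eq =
    contradiction eq (All.lookup x∉ (∈-lookup {xs = xs} j))
  lookup-injective {_ ∷ xs} (x∉ ∷ _) (Fin.suc i) Fin.zero eq =
    contradiction (sym eq) (All.lookup x∉ (∈-lookup {xs = xs} i))
  lookup-injective (_ ∷ u) (Fin.suc i) (Fin.suc j) eq = cong Fin.suc (lookup-injective u i j eq)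

  unique-length-≤ : ∀ {xs : List A} {M} → Unique xs → (g : A → Fin M) →
    (∀ {x y} → x ∈ xs → y ∈ xs → g x ≡ g y → x ≡ y) → length xs ℕ.≤ M
  unique-length-≤ {xs} u g g-inj = FinP.injective⇒≤ {f = λ i → g (lookup xs i)}
    (λ {i} {j} eq → lookup-injective u i j (g-inj (∈-lookup i) (∈-lookup j) eq))

  no-injective-family : ∀ (xs : List A) (f : ℕ → A) → (∀ {s t} → f s ≡ f t → s ≡ t) →
    ¬ (∀ t → f t ∈ xs)
  no-injective-family xs f f-inj f∈ = ℕP.1+n≰n
    (FinP.injective⇒≤ {f = λ (i : Fin (suc (length xs))) → Any.index (f∈ (toℕ i))}
      λ {i} {j} eq → FinP.toℕ-injective (f-inj (trans (lookup-index (f∈ (toℕ i)))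
        (trans (cong (lookup xs) eq) (sym (lookup-index (f∈ (toℕ j))))))))

-- Solutions as orbits of natural numbers.

module Orbit (a b : ℕ) where

  -- The solution continued to all indices, which removes index bounds; positive starting terms and
  -- nonnegative coefficients keep it in `ℕ`.
  orbit : ℕ → ℕ → ℕ → ℕ → ℕ
  orbit u v w 0 = u
  orbit u v w 1 = v
  orbit u v w 2 = w
  orbit u v w (suc (suc (suc i))) =
    a ℕ.* orbit u v w (suc (suc i)) ℕ.+ b ℕ.* orbit u v w (suc i) ℕ.+ orbit u v w i

  orbit-linear : ∀ t u v w u′ v′ w′ i →
    orbit (u ℕ.+ t ℕ.* u′) (v ℕ.+ t ℕ.* v′) (w ℕ.+ t ℕ.* w′) i ≡ orbit u v w i ℕ.+ t ℕ.* orbit u′ v′ w′ i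
  orbit-linear t u v w u′ v′ w′ 0 = refl
  orbit-linear t u v w u′ v′ w′ 1 = refl
  orbit-linear t u v w u′ v′ w′ 2 = refl
  orbit-linear t u v w u′ v′ w′ (suc (suc (suc i))) = trans
    (cong₂ ℕ._+_ (cong₂ ℕ._+_
      (cong (a ℕ.*_) (orbit-linear t u v w u′ v′ w′ (suc (suc i))))
      (cong (b ℕ.*_) (orbit-linear t u v w u′ v′ w′ (suc i))))
      (orbit-linear t u v w u′ v′ w′ i))
    (solve 9 (λ a b t x₂ x₁ x₀ y₂ y₁ y₀ →
      a :* (x₂ :+ t :* y₂) :+ b :* (x₁ :+ t :* y₁) :+ (x₀ :+ t :* y₀) :=
      (a :* x₂ :+ b :* x₁ :+ x₀) :+ t :* (a :* y₂ :+ b :* y₁ :+ y₀)) refl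
      a b t (o (suc (suc i))) (o (suc i)) (o i) (o′ (suc (suc i))) (o′ (suc i)) (o′ i))
    where
    open ℕSolver.+-*-Solver using (solve; _:+_; _:*_; _:=_)
    o o′ : ℕ → ℕ
    o  = orbit u v w
    o′ = orbit u′ v′ w′

  -- Because c = 1, a term is recovered from the three following ones by additive cancellation.
  orbit-backwards : ∀ {u v w u′ v′ w′} j → let x = orbit u v w ; y = orbit u′ v′ w′ in
    x j ≡ y j → x (1 ℕ.+ j) ≡ y (1 ℕ.+ j) → x (2 ℕ.+ j) ≡ y (2 ℕ.+ j) → u ≡ u′ × v ≡ v′ × w ≡ w′
  orbit-backwards zero e₀ e₁ e₂ = e₀ , e₁ , e₂
  orbit-backwards {u} {v} {w} {u′} {v′} {w′} (suc j) e₁ e₂ e₃ = orbit-backwards j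
    (ℕP.+-cancelˡ-≡ (a ℕ.* orbit u v w (suc (suc j)) ℕ.+ b ℕ.* orbit u v w (suc j)) _ _
      (trans e₃ (cong (ℕ._+ orbit u′ v′ w′ j)
        (cong₂ (λ p q → a ℕ.* p ℕ.+ b ℕ.* q) (sym e₂) (sym e₁)))))
    e₁ e₂

  lookup-ext : ∀ {k} {x y : Vec ℤ k} → (∀ i → Vec.lookup x i ≡ Vec.lookup y i) → x ≡ y
  lookup-ext {x = x} {y} eq =
    trans (sym (VecP.tabulate∘lookup x)) (trans (VecP.tabulate-cong eq) (VecP.tabulate∘lookup y))

  module Solution {n j : ℕ} {x : Vec ℤ (3 ℕ.+ j)} (sol : IsPositiveSolution a b 1 n (3 ℕ.+ j) x) where
    open IsPositiveSolution sol

    i₀ i₁ i₂ : Fin (3 ℕ.+ j)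
    i₀ = Fin.zero
    i₁ = Fin.suc Fin.zero
    i₂ = Fin.suc (Fin.suc Fin.zero)

    u v w : ℕ
    u = ℤ.∣ Vec.lookup x i₀ ∣
    v = ℤ.∣ Vec.lookup x i₁ ∣
    w = ℤ.∣ Vec.lookup x i₂ ∣

    terms : ℕ → ℕ
    terms = orbit u v w

    start-abs : ∀ i → toℕ i ℕ.< 3 → Vec.lookup x i ≡ + ℤ.∣ Vec.lookup x i ∣
    start-abs i i<3 = sym (ℤP.0≤i⇒+∣i∣≡i (ℤP.<⇒≤ (positive-start i i<3)))

    lookup-terms : ∀ i (i<k : i ℕ.< 3 ℕ.+ j) → Vec.lookup x (fromℕ< i<k) ≡ + terms i
    lookup-terms 0 _ = start-abs i₀ (ℕ.s≤s ℕ.z≤n)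
    lookup-terms 1 _ = start-abs i₁ (ℕ.s≤s (ℕ.s≤s ℕ.z≤n))
    lookup-terms 2 _ = start-abs i₂ (ℕ.s≤s (ℕ.s≤s (ℕ.s≤s ℕ.z≤n)))
    lookup-terms (suc (suc (suc i))) 3+i<k = begin
      Vec.lookup x (fromℕ< 3+i<k)
        ≡⟨ recurrence (fromℕ< i<k) (fromℕ< 1+i<k) (fromℕ< 2+i<k) (fromℕ< 3+i<k)
             (index 1+i<k i<k 1 refl) (index 2+i<k i<k 2 refl) (index 3+i<k i<k 3 refl) ⟩
      + a ℤ.* Vec.lookup x (fromℕ< 2+i<k) ℤ.+ + b ℤ.* Vec.lookup x (fromℕ< 1+i<k)
        ℤ.+ + 1 ℤ.* Vec.lookup x (fromℕ< i<k)
        ≡⟨ cong₂ ℤ._+_ (cong₂ ℤ._+_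
             (trans (cong (+ a ℤ.*_) (lookup-terms (suc (suc i)) 2+i<k)) (sym (ℤP.pos-* a _)))
             (trans (cong (+ b ℤ.*_) (lookup-terms (suc i) 1+i<k)) (sym (ℤP.pos-* b _))))
             (trans (ℤP.*-identityˡ _) (lookup-terms i i<k)) ⟩
      + terms (suc (suc (suc i))) ∎
      where
      open ≡-Reasoning
      2+i<k : 2 ℕ.+ i ℕ.< 3 ℕ.+ j
      2+i<k = ℕP.<-trans (ℕP.n<1+n _) 3+i<k
      1+i<k : 1 ℕ.+ i ℕ.< 3 ℕ.+ j
      1+i<k = ℕP.<-trans (ℕP.n<1+n _) 2+i<k
      i<k : i ℕ.< 3 ℕ.+ j
      i<k = ℕP.<-trans (ℕP.n<1+n _) 1+i<k
      index : ∀ {l m} (l<k : l ℕ.< 3 ℕ.+ j) (m<k : m ℕ.< 3 ℕ.+ j) s → l ≡ s ℕ.+ m →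
        toℕ (fromℕ< l<k) ≡ s ℕ.+ toℕ (fromℕ< m<k)
      index l<k m<k s eq = trans (FinP.toℕ-fromℕ< l<k)
        (trans eq (cong (s ℕ.+_) (sym (FinP.toℕ-fromℕ< m<k))))

    lookup≡terms : ∀ i → Vec.lookup x i ≡ + terms (toℕ i)
    lookup≡terms i = trans (cong (Vec.lookup x) (sym (FinP.fromℕ<-toℕ i (FinP.toℕ<n i))))
      (lookup-terms (toℕ i) (FinP.toℕ<n i))

    last-term : terms (2 ℕ.+ j) ≡ n
    last-term = ℤP.+-injective (trans (sym (lookup-terms (2 ℕ.+ j) ℕP.≤-refl))
      (terminates (fromℕ< {2 ℕ.+ j} ℕP.≤-refl) (cong suc (FinP.toℕ-fromℕ< {2 ℕ.+ j} ℕP.≤-refl))))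

  solution-injective : ∀ {n j} {x y : Vec ℤ (3 ℕ.+ j)}
    (X : IsPositiveSolution a b 1 n (3 ℕ.+ j) x) (Y : IsPositiveSolution a b 1 n (3 ℕ.+ j) y) →
    Solution.terms X (1 ℕ.+ j) ≡ Solution.terms Y (1 ℕ.+ j) → Solution.terms X j ≡ Solution.terms Y j →
    x ≡ y
  solution-injective {j = j} X Y e₁ e₀
    with orbit-backwards j e₀ e₁ (trans (Solution.last-term X) (sym (Solution.last-term Y)))
  ... | eᵤ , eᵥ , e_w = lookup-ext λ i → trans (Solution.lookup≡terms X i)
    (trans (cong (λ f → + f (toℕ i)) (trans (cong (λ u → orbit u _ _) eᵤ)
      (cong₂ (orbit _) eᵥ e_w))) (sym (Solution.lookup≡terms Y i)))

  orbit-solution : ∀ {u v w n j} → 0 ℕ.< u → 0 ℕ.< v → 0 ℕ.< w → orbit u v w (2 ℕ.+ j) ≡ n →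
    IsPositiveSolution a b 1 n (3 ℕ.+ j) (tabulate (λ i → + orbit u v w (toℕ i)))
  orbit-solution {u} {v} {w} {n} {j} 0<u 0<v 0<w last = record
    { positive-start = λ i i<3 → subst (ℤ.0ℤ ℤ.<_) (sym (at i)) (ℤ.+<+ (positive (toℕ i) i<3))
    ; recurrence = λ i₀ i₁ i₂ i₃ e₁ e₂ e₃ → begin
        Vec.lookup x i₃
          ≡⟨ trans (at i₃) (cong (λ i → + o i) e₃) ⟩
        + (a ℕ.* o (2 ℕ.+ toℕ i₀)) ℤ.+ + (b ℕ.* o (1 ℕ.+ toℕ i₀)) ℤ.+ + o (toℕ i₀)
          ≡⟨ cong₂ ℤ._+_ (cong₂ ℤ._+_
               (trans (ℤP.pos-* a _) (cong (+ a ℤ.*_) (sym (trans (at i₂) (cong (λ i → + o i) e₂)))))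
               (trans (ℤP.pos-* b _) (cong (+ b ℤ.*_) (sym (trans (at i₁) (cong (λ i → + o i) e₁))))))
               (trans (sym (at i₀)) (sym (ℤP.*-identityˡ _))) ⟩
        + a ℤ.* Vec.lookup x i₂ ℤ.+ + b ℤ.* Vec.lookup x i₁ ℤ.+ + 1 ℤ.* Vec.lookup x i₀ ∎
    ; terminates = λ i e → trans (at i) (cong +_ (trans (cong o (ℕP.suc-injective e)) last))
    }
    where
    open ≡-Reasoning
    o : ℕ → ℕ
    o = orbit u v w
    x : Vec ℤ (3 ℕ.+ j)
    x = tabulate (λ i → + o (toℕ i))
    at : ∀ i → Vec.lookup x i ≡ + o (toℕ i)
    at = VecP.lookup∘tabulate (λ i → + o (toℕ i))
    positive : ∀ i → i ℕ.< 3 → 0 ℕ.< o i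
    positive 0 _ = 0<u
    positive 1 _ = 0<v
    positive 2 _ = 0<w
    positive (suc (suc (suc i))) (ℕ.s≤s (ℕ.s≤s (ℕ.s≤s ())))

  -- A nonzero nonnegative orbit that vanishes at the end can be added to any
  -- solution arbitrarily often.
  vanishing-orbit⇒none : ∀ u′ v′ w′ {n j N} → u′ ℕ.+ v′ ℕ.+ w′ ≡ 1 → orbit u′ v′ w′ (2 ℕ.+ j) ≡ 0 →
    HasCardinality (IsPositiveSolution a b 1 n (3 ℕ.+ j)) N → N ≡ 0
  vanishing-orbit⇒none _ _ _ _ _ ([] , _ , _ , refl) = refl
  vanishing-orbit⇒none u′ v′ w′ {n} {j} sum≡1 end≡0 (xs@(x ∷ _) , _ , char , _) =
    contradiction (λ t → Equivalence.from (char (family t)) (family-solution t))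
      (no-injective-family xs family λ {s} {t} → family-injective s t)
    where
    sol : IsPositiveSolution a b 1 n (3 ℕ.+ j) x
    sol = Equivalence.to (char x) (Any.here refl)
    open Solution sol using (u; v; w; i₀; i₁; i₂; last-term)
    open IsPositiveSolution sol using (positive-start)

    shifted : ℕ → Fin (3 ℕ.+ j) → ℤ
    shifted t i = + orbit (u ℕ.+ t ℕ.* u′) (v ℕ.+ t ℕ.* v′) (w ℕ.+ t ℕ.* w′) (toℕ i)

    family : ℕ → Vec ℤ (3 ℕ.+ j)
    family t = tabulate (shifted t)

    abs-pos : ∀ {i} → ℤ.0ℤ ℤ.< i → 0 ℕ.< ℤ.∣ i ∣
    abs-pos (ℤ.+<+ 0<i) = 0<i

    family-solution : ∀ t → IsPositiveSolution a b 1 n (3 ℕ.+ j) (family t)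
    family-solution t = orbit-solution
      (ℕP.m≤n⇒m≤n+o _ (abs-pos (positive-start i₀ (ℕ.s≤s ℕ.z≤n))))
      (ℕP.m≤n⇒m≤n+o _ (abs-pos (positive-start i₁ (ℕ.s≤s (ℕ.s≤s ℕ.z≤n)))))
      (ℕP.m≤n⇒m≤n+o _ (abs-pos (positive-start i₂ (ℕ.s≤s (ℕ.s≤s (ℕ.s≤s ℕ.z≤n))))))
      (trans (orbit-linear t u v w u′ v′ w′ (2 ℕ.+ j))
        (trans (cong₂ (λ p q → p ℕ.+ t ℕ.* q) last-term end≡0)
          (trans (cong (n ℕ.+_) (ℕP.*-zeroʳ t)) (ℕP.+-identityʳ n))))

    -- The sum of the starting terms recovers t, which makes the family injective.
    start-sum : ∀ t → (u ℕ.+ t ℕ.* u′) ℕ.+ (v ℕ.+ t ℕ.* v′) ℕ.+ (w ℕ.+ t ℕ.* w′) ≡ u ℕ.+ v ℕ.+ w ℕ.+ t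
    start-sum t = trans
      (solve 7 (λ u v w t u′ v′ w′ → (u :+ t :* u′) :+ (v :+ t :* v′) :+ (w :+ t :* w′) :=
        u :+ v :+ w :+ t :* (u′ :+ v′ :+ w′)) refl u v w t u′ v′ w′)
      (cong (u ℕ.+ v ℕ.+ w ℕ.+_) (trans (cong (t ℕ.*_) sum≡1) (ℕP.*-identityʳ t)))
      where open ℕSolver.+-*-Solver using (solve; _:+_; _:*_; _:=_)

    family-injective : ∀ s t → family s ≡ family t → s ≡ t
    family-injective s t eq = ℕP.+-cancelˡ-≡ (u ℕ.+ v ℕ.+ w) s t
      (trans (sym (start-sum s)) (trans
        (cong₂ ℕ._+_ (cong₂ ℕ._+_ (at i₀) (at i₁)) (at i₂)) (start-sum t)))
      where
      at : ∀ i → ℤ.∣ shifted s i ∣ ≡ ℤ.∣ shifted t i ∣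
      at i = cong ℤ.∣_∣ (trans (sym (VecP.lookup∘tabulate (shifted s) i))
        (trans (cong (λ f → Vec.lookup f i) eq) (VecP.lookup∘tabulate (shifted t) i)))

  Dominated : ℕ → Set
  Dominated j = ∀ u v w → let x = orbit u v w in
    x (1 ℕ.+ j) ℕ.≤ suc b ℕ.* x (2 ℕ.+ j) × x j ℕ.≤ suc b ℕ.* x (2 ℕ.+ j)

-- Comparison of the last three terms.

≤-suc* : ∀ b {x y} → x ℕ.≤ y → x ℕ.≤ suc b ℕ.* y
≤-suc* b {x} {y} x≤y = ℕP.≤-trans x≤y (ℕP.m≤m+n y (b ℕ.* y))

-- A term of index at least 3 is a nonnegative combination of the starting terms. A zero coefficient
-- in x_k is possible only in the exceptional cases: x₄ = a x₃ + x₁ omits x₂ when b = 0, x₄ = b x₂ +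
-- x₁ omits x₃ when a = 0, and x₅ = b x₃ + x₂ omits x₁ when a = 0. Otherwise monotonicity or a
-- direct expansion gives the bounds.
dominated-or-none : ∀ a b → 1 ℕ.≤ a ℕ.+ b → ∀ j {n N} →
  HasCardinality (IsPositiveSolution a b 1 n (4 ℕ.+ j)) N → Orbit.Dominated a b (1 ℕ.+ j) ⊎ N ≡ 0
dominated-or-none (suc a) b _ (suc j) _ = inj₁ λ u v w →
  let x = Orbit.orbit (suc a) b u v w
      step : ∀ i → x (2 ℕ.+ i) ℕ.≤ x (3 ℕ.+ i)
      step i = ℕP.m≤n⇒m≤n+o (x i) (ℕP.m≤n⇒m≤n+o (b ℕ.* x (1 ℕ.+ i)) (ℕP.m≤m+n _ (a ℕ.* x (2 ℕ.+ i))))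
  in ≤-suc* b (step (1 ℕ.+ j)) , ≤-suc* b (ℕP.≤-trans (step j) (step (1 ℕ.+ j)))
dominated-or-none (suc a) (suc b) _ zero _ = inj₁ λ u v w →
  ≤-suc* (suc b) (ℕP.m≤n⇒m≤n+o u (ℕP.m≤n⇒m≤n+o (suc b ℕ.* v) (ℕP.m≤m+n w (a ℕ.* w)))) ,
  ≤-suc* (suc b) (ℕP.m≤n⇒m≤n+o u (ℕP.m≤n⇒m≤o+n (suc a ℕ.* w) (ℕP.m≤m+n v (b ℕ.* v))))
dominated-or-none (suc a) zero _ zero card = inj₂
  (Orbit.vanishing-orbit⇒none (suc a) 0 0 1 0 refl
    (trans (ℕP.+-identityʳ _) (trans (ℕP.+-identityʳ _) (ℕP.*-zeroʳ (suc a)))) card)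
dominated-or-none zero (suc b) _ 0 card = inj₂
  (Orbit.vanishing-orbit⇒none 0 (suc b) 0 0 1 refl
    (trans (ℕP.+-identityʳ _) (ℕP.*-zeroʳ (suc b))) card)
dominated-or-none zero (suc b) _ 1 card = inj₂
  (Orbit.vanishing-orbit⇒none 0 (suc b) 1 0 0 refl
    (trans (ℕP.+-identityʳ _) (ℕP.*-zeroʳ (suc b))) card)
-- With a = 0 only terms two apart are monotone. The penultimate term is therefore unfolded once and
-- both terms in it are compared with the last one.
dominated-or-none zero (suc b) _ (suc (suc j)) _ = inj₁ λ u v w →
  let x = Orbit.orbit 0 (suc b) u v w
      step : ∀ i → x (1 ℕ.+ i) ℕ.≤ x (3 ℕ.+ i)
      step i = ℕP.m≤n⇒m≤n+o (x i) (ℕP.m≤m+n (x (1 ℕ.+ i)) (b ℕ.* x (1 ℕ.+ i)))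
      end = x (5 ℕ.+ j)
      x₂≤end : x (2 ℕ.+ j) ℕ.≤ end
      x₂≤end = ℕP.m≤n+m (x (2 ℕ.+ j)) (suc b ℕ.* x (3 ℕ.+ j))
      x₁≤end : x (1 ℕ.+ j) ℕ.≤ end
      x₁≤end = ℕP.≤-trans (step j) (step (2 ℕ.+ j))
  in ℕP.≤-trans (ℕP.+-mono-≤ (ℕP.*-monoʳ-≤ (suc b) x₂≤end) x₁≤end)
       (ℕP.≤-reflexive (ℕP.+-comm (suc b ℕ.* end) end)) ,
     ≤-suc* (suc b) (step (2 ℕ.+ j))

same-residue : ∀ m .{{_ : ℕ.NonZero m}} x y → x ℕD.% m ≡ y ℕD.% m →
  ∃[ t ] + x ℤ.- + y ≡ t ℤ.* + m
same-residue m x y eq = + (x ℕD./ m) ℤ.- + (y ℕD./ m) , (begin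
  + x ℤ.- + y
    ≡⟨ cong₂ (λ p q → + p ℤ.- + q) (ℕD.m≡m%n+[m/n]*n x m) (ℕD.m≡m%n+[m/n]*n y m) ⟩
  + (x ℕD.% m ℕ.+ x ℕD./ m ℕ.* m) ℤ.- + (y ℕD.% m ℕ.+ y ℕD./ m ℕ.* m)
    ≡⟨ cong₂ (λ p q → (+ (x ℕD.% m) ℤ.+ p) ℤ.- q) (ℤP.pos-* (x ℕD./ m) m)
         (cong₂ ℤ._+_ (cong +_ (sym eq)) (ℤP.pos-* (y ℕD./ m) m)) ⟩
  (+ (x ℕD.% m) ℤ.+ + (x ℕD./ m) ℤ.* + m) ℤ.- (+ (x ℕD.% m) ℤ.+ + (y ℕD./ m) ℤ.* + m)
    ≡⟨ solve 4 (λ r p q m → (r :+ p :* m) :- (r :+ q :* m) := (p :- q) :* m) refl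
         (+ (x ℕD.% m)) (+ (x ℕD./ m)) (+ (y ℕD./ m)) (+ m) ⟩
  (+ (x ℕD./ m) ℤ.- + (y ℕD./ m)) ℤ.* + m ∎)
  where
  open ≡-Reasoning
  open ℤSolver.+-*-Solver using (solve; _:+_; _:-_; _:*_; _:=_)

-- Rational estimates.

module Rationals where
  open import Data.Rational.Base
  open import Data.Rational.Properties
  open ℚSolver.+-*-Solver using (solve; _:+_; _:*_; _:-_; :-_; _:=_)
  import Data.Rational.Unnormalised.Base as ℚᵘ
  import Data.Rational.Unnormalised.Properties as ℚᵘP

  toℚᵘ-fromℤ : ∀ i → toℚᵘ (fromℤ i) ℚᵘ.≃ ℚᵘ.mkℚᵘ i 0
  toℚᵘ-fromℤ i = toℚᵘ-fromℚᵘ (ℚᵘ.mkℚᵘ i 0)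

  fromℤ-+ : ∀ i j → fromℤ (i ℤ.+ j) ≡ fromℤ i + fromℤ j
  fromℤ-+ i j = toℚᵘ-injective (begin
    toℚᵘ (fromℤ (i ℤ.+ j))                ≈⟨ toℚᵘ-fromℤ (i ℤ.+ j) ⟩
    ℚᵘ.mkℚᵘ (i ℤ.+ j) 0
      ≈⟨ ℚᵘ.*≡* (cong (ℤ._* + 1) (sym (cong₂ ℤ._+_ (ℤP.*-identityʳ i) (ℤP.*-identityʳ j)))) ⟩
    ℚᵘ.mkℚᵘ i 0 ℚᵘ.+ ℚᵘ.mkℚᵘ j 0          ≈⟨ ℚᵘP.+-cong (toℚᵘ-fromℤ i) (toℚᵘ-fromℤ j) ⟨
    toℚᵘ (fromℤ i) ℚᵘ.+ toℚᵘ (fromℤ j)    ≈⟨ toℚᵘ-homo-+ (fromℤ i) (fromℤ j) ⟨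
    toℚᵘ (fromℤ i + fromℤ j)              ∎)
    where open ℚᵘP.≃-Reasoning

  fromℤ-* : ∀ i j → fromℤ (i ℤ.* j) ≡ fromℤ i * fromℤ j
  fromℤ-* i j = toℚᵘ-injective (begin
    toℚᵘ (fromℤ (i ℤ.* j))                ≈⟨ toℚᵘ-fromℤ (i ℤ.* j) ⟩
    ℚᵘ.mkℚᵘ i 0 ℚᵘ.* ℚᵘ.mkℚᵘ j 0          ≈⟨ ℚᵘP.*-cong (toℚᵘ-fromℤ i) (toℚᵘ-fromℤ j) ⟨
    toℚᵘ (fromℤ i) ℚᵘ.* toℚᵘ (fromℤ j)    ≈⟨ toℚᵘ-homo-* (fromℤ i) (fromℤ j) ⟨
    toℚᵘ (fromℤ i * fromℤ j)              ∎)
    where open ℚᵘP.≃-Reasoning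

  fromℤ-neg : ∀ i → fromℤ (ℤ.- i) ≡ - fromℤ i
  fromℤ-neg i = toℚᵘ-injective (begin
    toℚᵘ (fromℤ (ℤ.- i))    ≈⟨ toℚᵘ-fromℤ (ℤ.- i) ⟩
    ℚᵘ.- ℚᵘ.mkℚᵘ i 0        ≈⟨ ℚᵘP.-‿cong (toℚᵘ-fromℤ i) ⟨
    ℚᵘ.- toℚᵘ (fromℤ i)     ≈⟨ toℚᵘ-homo‿- (fromℤ i) ⟨
    toℚᵘ (- fromℤ i)        ∎)
    where open ℚᵘP.≃-Reasoning

  fromℤ-mono : ∀ {i j} → i ℤ.≤ j → fromℤ i ≤ fromℤ j
  fromℤ-mono {i} {j} i≤j = toℚᵘ-cancel-≤ (begin
    toℚᵘ (fromℤ i)   ≃⟨ toℚᵘ-fromℤ i ⟩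
    ℚᵘ.mkℚᵘ i 0      ≤⟨ ℚᵘ.*≤* (ℤP.*-monoʳ-≤-nonNeg (+ 1) i≤j) ⟩
    ℚᵘ.mkℚᵘ j 0      ≃⟨ toℚᵘ-fromℤ j ⟨
    toℚᵘ (fromℤ j)   ∎)
    where open ℚᵘP.≤-Reasoning

  half<1 : half 1ℚ < 1ℚ
  half<1 = subst (half 1ℚ <_) (half-sum 1ℚ)
    (subst (_< half 1ℚ + half 1ℚ) (+-identityʳ (half 1ℚ)) (+-monoʳ-< (half 1ℚ) (0<half 0<1)))

  -- The slack is needed because the order on reals yields comparisons of approximations only up to
  -- an error; distinct integers are 1 apart, so one half is harmless.
  fromℤ-cancel : ∀ {i j} → fromℤ i ≤ fromℤ j + half 1ℚ → i ℤ.≤ j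
  fromℤ-cancel {i} {j} i≤j+½ = ℤP.≮⇒≥ λ j<i → <⇒≱
    (<-≤-trans (+-monoʳ-< (fromℤ j) half<1)
      (subst (_≤ fromℤ i) (trans (fromℤ-+ (+ 1) j) (+-comm 1ℚ (fromℤ j)))
        (fromℤ-mono (ℤP.i<j⇒suc[i]≤j j<i)))) i≤j+½

  square-nonneg : ∀ p → 0ℚ ≤ p * p
  square-nonneg p with ≤-total 0ℚ p
  ... | inj₁ 0≤p = 0≤-*-0≤ {p} {p} 0≤p 0≤p
  ... | inj₂ p≤0 = subst (0ℚ ≤_) (solve 1 (λ p → (:- p) :* (:- p) := p :* p) refl p)
    (0≤-*-0≤ { - p} { - p} (neg-antimono-≤ p≤0) (neg-antimono-≤ p≤0))

  ∣-∣≤⇒≤ : ∀ {p q} → ∣ p ∣ ≤ q → p ≤ q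
  ∣-∣≤⇒≤ {p} = ≤-trans (p≤∣p∣ p)

  half≤ : ∀ {ε} → 0ℚ < ε → half ε ≤ ε
  half≤ {ε} 0<ε = ≤-trans (≤-reflexive (sym (+-identityʳ (half ε))))
    (≤-trans (+-monoʳ-≤ (half ε) (<⇒≤ (0<half 0<ε))) (≤-reflexive (half-sum ε)))

  half< : ∀ {ε} → 0ℚ < ε → half ε < ε
  half< {ε} 0<ε = ≤-<-trans (≤-reflexive (sym (+-identityʳ (half ε))))
    (<-≤-trans (+-monoʳ-< (half ε) (0<half 0<ε)) (≤-reflexive (half-sum ε)))

  product-nonneg : ∀ {x y δ B C} → 0ℚ ≤ δ → δ ≤ 1ℚ → x ≤ B → y ≤ C →
    0ℚ ≤ x + δ → 0ℚ ≤ y + δ → 0ℚ ≤ x * y + δ * (B + C + 1ℚ)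
  product-nonneg {x} {y} {δ} {B} {C} 0≤δ δ≤1 x≤B y≤C 0≤x+δ 0≤y+δ = begin
    0ℚ                              ≤⟨ 0≤-*-0≤ {x + δ} {y + δ} 0≤x+δ 0≤y+δ ⟩
    (x + δ) * (y + δ)
      ≡⟨ solve 3 (λ x y δ → (x :+ δ) :* (y :+ δ) := x :* y :+ δ :* (x :+ y :+ δ)) refl x y δ ⟩
    x * y + δ * (x + y + δ)
      ≤⟨ +-monoʳ-≤ (x * y) (*-monoˡ-≤-nonNeg δ {{nonNegative 0≤δ}}
           (+-mono-≤ (+-mono-≤ x≤B y≤C) δ≤1)) ⟩
    x * y + δ * (B + C + 1ℚ)        ∎
    where open ≤-Reasoning

  product-close : ∀ {p p′ q q′ B C δ} → 0ℚ < B → 0ℚ < C → ∣ p ∣ ≤ B → ∣ q′ ∣ ≤ C →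
    ∣ p - p′ ∣ < δ → ∣ q - q′ ∣ < δ → ∣ p * q - p′ * q′ ∣ < δ * (B + C)
  product-close {p} {p′} {q} {q′} {B} {C} {δ} 0<B 0<C p≤B q′≤C p-p′ q-q′ = begin-strict
    ∣ p * q - p′ * q′ ∣
      ≡⟨ cong ∣_∣ (solve 4 (λ p p′ q q′ → p :* q :- p′ :* q′ := p :* (q :- q′) :+ q′ :* (p :- p′))
           refl p p′ q q′) ⟩
    ∣ p * (q - q′) + q′ * (p - p′) ∣
      ≤⟨ ∣p+q∣≤∣p∣+∣q∣ (p * (q - q′)) (q′ * (p - p′)) ⟩
    ∣ p * (q - q′) ∣ + ∣ q′ * (p - p′) ∣
      <⟨ +-mono-< (∣-∣-*-< {p} {q - q′} 0<B p≤B q-q′) (∣-∣-*-< {q′} {p - p′} 0<C q′≤C p-p′) ⟩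
    B * δ + C * δ
      ≡⟨ solve 3 (λ B C δ → B :* δ :+ C :* δ := δ :* (B :+ C)) refl B C δ ⟩
    δ * (B + C) ∎
    where open ≤-Reasoning

  square-gap : ∀ {q s u δ B} → 0ℚ ≤ s → 0ℚ ≤ u → u ≤ δ → u ≤ 1ℚ → s ≤ B →
    q < (s + u) * (s + u) → q < s * s + δ * (B + B + 1ℚ)
  square-gap {q} {s} {u} {δ} {B} 0≤s 0≤u u≤δ u≤1 s≤B q< = begin-strict
    q                           <⟨ q< ⟩
    (s + u) * (s + u)
      ≡⟨ solve 2 (λ s u → (s :+ u) :* (s :+ u) := s :* s :+ u :* (s :+ s :+ u)) refl s u ⟩
    s * s + u * (s + s + u)
      ≤⟨ +-monoʳ-≤ (s * s) (*-mono-≤-0≤ {u} {δ} {s + s + u} 0≤u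
           (0≤-+-0≤ {s + s} {u} (0≤-+-0≤ {s} {s} 0≤s 0≤s) 0≤u) u≤δ
           (+-mono-≤ (+-mono-≤ s≤B s≤B) u≤1)) ⟩
    s * s + δ * (B + B + 1ℚ)    ∎
    where open ≤-Reasoning

  quotient : ∀ {ε K} → 0ℚ < ε → 0ℚ < K → ∃[ δ ] 0ℚ < δ × δ * K ≡ ε
  quotient {ε} {K} 0<ε 0<K = ε * recip K 0<K , 0<-*-0< {ε} 0<ε (0<recip K 0<K) ,
    trans (*-assoc ε (recip K 0<K) K)
      (trans (cong (ε *_) (trans (*-comm (recip K 0<K) K) (recip-inv K 0<K))) (*-identityʳ ε))

  ≤-difference : ∀ {p q r} → p ≤ q + r → p - q ≤ r
  ≤-difference {p} {q} {r} p≤q+r = subst (p - q ≤_)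
    (solve 2 (λ q r → q :+ r :- q := r) refl q r) (+-monoˡ-≤ (- q) p≤q+r)

  difference-≤ : ∀ {p q r} → p - q ≤ r → p ≤ q + r
  difference-≤ {p} {q} {r} p-q≤r = subst (_≤ q + r)
    (solve 2 (λ p q → q :+ (p :- q) := p) refl p q) (+-monoʳ-≤ q p-q≤r)

  <-difference : ∀ {p q r} → p < q + r → p - q < r
  <-difference {p} {q} {r} p<q+r = subst (p - q <_)
    (solve 2 (λ q r → q :+ r :- q := r) refl q r) (+-monoˡ-< (- q) p<q+r)

  +-interchange : ∀ p q r s → (p + q) + (r + s) ≡ (p + r) + (q + s)
  +-interchange = solve 4 (λ p q r s → (p :+ q) :+ (r :+ s) := (p :+ r) :+ (q :+ s)) refl

-- The Cauchy reals as an ordered ring.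

module Reals where
  open import Data.Rational.Base
  open import Data.Rational.Properties
  open ℚSolver.+-*-Solver using (solve; _:+_; _:*_; _:-_; :-_; _:=_)
  open Rationals

  Eventually : (ℕ → Set) → Set
  Eventually P = ∃[ N ] (∀ n → N ℕ.≤ n → P n)

  always : ∀ {P} → (∀ n → P n) → Eventually P
  always p = 0 , λ n _ → p n

  eventually : ∀ {P Q} → (∀ n → P n → Q n) → Eventually P → Eventually Q
  eventually f (N , p) = N , λ n n≥ → f n (p n n≥)

  eventually₂ : ∀ {P Q R} → (∀ n → P n → Q n → R n) → Eventually P → Eventually Q → Eventually R
  eventually₂ f (N , p) (M , q) = N ℕ.⊔ M , λ n n≥ →
    f n (p n (ℕP.m⊔n≤o⇒m≤o N M n≥)) (q n (ℕP.m⊔n≤o⇒n≤o N M n≥))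

  both : ∀ {P Q} → Eventually P → Eventually Q → Eventually (λ n → P n × Q n)
  both = eventually₂ λ _ p q → p , q

  satisfiable : ∀ {P} → Eventually P → ∃[ n ] P n
  satisfiable (N , p) = N , p N ℕP.≤-refl

  Bounded : ℝ → Set
  Bounded x = ∃[ B ] 0ℚ < B × Eventually (λ n → ∣ seq x n ∣ ≤ B)

  bounded : ∀ x → Bounded x
  bounded x = bound (cauchy x 1ℚ 0<1)
    where
    bound : (∃[ N ] (∀ m n → N ℕ.≤ m → N ℕ.≤ n → ∣ seq x m - seq x n ∣ < 1ℚ)) → Bounded x
    bound (N , h) = ∣ seq x N ∣ + 1ℚ , 0<∣p∣+1 (seq x N) , N , λ n n≥ →
      ∣-∣-bound {seq x n} {seq x N} {1ℚ} (h n N n≥ ℕP.≤-refl)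

  ∣p-p∣<ε : ∀ {p q ε} → 0ℚ < ε → p ≡ q → ∣ p - q ∣ < ε
  ∣p-p∣<ε {p} {ε = ε} 0<ε refl = subst (λ r → ∣ r ∣ < ε) (sym (+-inverseʳ p)) 0<ε

  eventually≡⇒≈ : ∀ {x y} → Eventually (λ n → seq x n ≡ seq y n) → x ≈ᴿ y
  eventually≡⇒≈ e ε 0<ε = eventually (λ _ → ∣p-p∣<ε 0<ε) e

  pointwise : ∀ {x y} → (∀ n → seq x n ≡ seq y n) → x ≈ᴿ y
  pointwise {x} {y} p = eventually≡⇒≈ {x} {y} (always p)

  ≈-sym : ∀ {x y} → x ≈ᴿ y → y ≈ᴿ x
  ≈-sym {x} {y} x≈y ε 0<ε =
    eventually (λ n → subst (_< ε) (∣-∣-swap (seq x n) (seq y n))) (x≈y ε 0<ε)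

  ≈-trans : ∀ {x y z} → x ≈ᴿ y → y ≈ᴿ z → x ≈ᴿ z
  ≈-trans {x} {y} {z} x≈y y≈z ε 0<ε = eventually₂
    (λ n p q → subst (∣ seq x n - seq z n ∣ <_) (half-sum ε) (≤-<-trans
      (subst (_≤ ∣ seq x n - seq y n ∣ + ∣ seq y n - seq z n ∣)
        (cong ∣_∣ (solve 3 (λ a b c → (a :- b) :+ (b :- c) := a :- c) refl (seq x n) (seq y n) (seq z n)))
        (∣p+q∣≤∣p∣+∣q∣ (seq x n - seq y n) (seq y n - seq z n)))
      (+-mono-< p q)))
    (x≈y (half ε) (0<half 0<ε)) (y≈z (half ε) (0<half 0<ε))

  ≈-isEquivalence : IsEquivalence _≈ᴿ_
  ≈-isEquivalence = record
    { refl  = λ {x} → pointwise {x} {x} λ _ → refl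
    ; sym   = λ {x} {y} → ≈-sym {x} {y}
    ; trans = λ {x} {y} {z} → ≈-trans {x} {y} {z}
    }

  +-cong-≈ : ∀ {x x′ y y′} → x ≈ᴿ x′ → y ≈ᴿ y′ → x +ᴿ y ≈ᴿ x′ +ᴿ y′
  +-cong-≈ {x} {x′} {y} {y′} x≈ y≈ ε 0<ε = eventually₂
    (λ n p q → subst (∣ (seq x n + seq y n) - (seq x′ n + seq y′ n) ∣ <_) (half-sum ε) (≤-<-trans
      (subst (_≤ ∣ seq x n - seq x′ n ∣ + ∣ seq y n - seq y′ n ∣)
        (cong ∣_∣ (solve 4 (λ a a′ b b′ → (a :- a′) :+ (b :- b′) := (a :+ b) :- (a′ :+ b′)) refl
          (seq x n) (seq x′ n) (seq y n) (seq y′ n)))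
        (∣p+q∣≤∣p∣+∣q∣ (seq x n - seq x′ n) (seq y n - seq y′ n)))
      (+-mono-< p q)))
    (x≈ (half ε) (0<half 0<ε)) (y≈ (half ε) (0<half 0<ε))

  neg-cong-≈ : ∀ {x y} → x ≈ᴿ y → -ᴿ x ≈ᴿ -ᴿ y
  neg-cong-≈ {x} {y} x≈y ε 0<ε = eventually
    (λ n → subst (_< ε) (trans (∣-∣-swap (seq x n) (seq y n))
      (cong ∣_∣ (solve 2 (λ a b → b :- a := (:- a) :- (:- b)) refl (seq x n) (seq y n)))))
    (x≈y ε 0<ε)

  *-cong-≈ : ∀ {x x′ y y′} → x ≈ᴿ x′ → y ≈ᴿ y′ → x *ᴿ y ≈ᴿ x′ *ᴿ y′
  *-cong-≈ {x} {x′} {y} {y′} x≈ y≈ ε 0<ε = conclude (bounded x) (bounded y′)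
    where
    conclude : Bounded x → Bounded y′ → Eventually (λ n → ∣ seq x n * seq y n - seq x′ n * seq y′ n ∣ < ε)
    conclude (B , 0<B , x≤B) (C , 0<C , y′≤C) = scaled (quotient 0<ε (0<-+-0≤ {B} {C} 0<B (<⇒≤ 0<C)))
      where
      scaled : (∃[ δ ] 0ℚ < δ × δ * (B + C) ≡ ε) →
        Eventually (λ n → ∣ seq x n * seq y n - seq x′ n * seq y′ n ∣ < ε)
      scaled (δ , 0<δ , δ[B+C]≡ε) = eventually₂
        (λ n (p , p≤B) (q , q≤C) →
          subst (∣ seq x n * seq y n - seq x′ n * seq y′ n ∣ <_) δ[B+C]≡ε
            (product-close {seq x n} {seq x′ n} {seq y n} {seq y′ n} {B} {C} {δ} 0<B 0<C p≤B q≤C p q))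
        (both (x≈ δ 0<δ) x≤B) (both (y≈ δ 0<δ) y′≤C)

  ring : CommutativeRing 0ℓ 0ℓ
  ring = record
    { Carrier = ℝ ; _≈_ = _≈ᴿ_ ; _+_ = _+ᴿ_ ; _*_ = _*ᴿ_ ; -_ = -ᴿ_ ; 0# = 0ᴿ ; 1# = 1ᴿ
    ; isCommutativeRing = record
      { isRing = record
        { +-isAbelianGroup = record
          { isGroup = record
            { isMonoid = record
              { isSemigroup = record
                { isMagma = record
                  { isEquivalence = ≈-isEquivalence
                  ; ∙-cong = λ {x} {x′} {y} {y′} → +-cong-≈ {x} {x′} {y} {y′} }
                ; assoc = λ x y z → pointwise {(x +ᴿ y) +ᴿ z} {x +ᴿ (y +ᴿ z)}
                    λ n → +-assoc (seq x n) (seq y n) (seq z n) }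
              ; identity = (λ x → pointwise {0ᴿ +ᴿ x} {x} λ n → +-identityˡ (seq x n))
                         , (λ x → pointwise {x +ᴿ 0ᴿ} {x} λ n → +-identityʳ (seq x n)) }
            ; inverse = (λ x → pointwise { -ᴿ x +ᴿ x} {0ᴿ} λ n → +-inverseˡ (seq x n))
                      , (λ x → pointwise {x -ᴿ x} {0ᴿ} λ n → +-inverseʳ (seq x n))
            ; ⁻¹-cong = λ {x} {y} → neg-cong-≈ {x} {y} }
          ; comm = λ x y → pointwise {x +ᴿ y} {y +ᴿ x} λ n → +-comm (seq x n) (seq y n) }
        ; *-cong = λ {x} {x′} {y} {y′} → *-cong-≈ {x} {x′} {y} {y′}
        ; *-assoc = λ x y z → pointwise {(x *ᴿ y) *ᴿ z} {x *ᴿ (y *ᴿ z)}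
            λ n → *-assoc (seq x n) (seq y n) (seq z n)
        ; *-identity = (λ x → pointwise {1ᴿ *ᴿ x} {x} λ n → *-identityˡ (seq x n))
                     , (λ x → pointwise {x *ᴿ 1ᴿ} {x} λ n → *-identityʳ (seq x n))
        ; distrib = (λ x y z → pointwise {x *ᴿ (y +ᴿ z)} {x *ᴿ y +ᴿ x *ᴿ z}
                        λ n → *-distribˡ-+ (seq x n) (seq y n) (seq z n))
                  , (λ x y z → pointwise {(y +ᴿ z) *ᴿ x} {y *ᴿ x +ᴿ z *ᴿ x}
                        λ n → *-distribʳ-+ (seq x n) (seq y n) (seq z n)) }
      ; *-comm = λ x y → pointwise {x *ᴿ y} {y *ᴿ x} λ n → *-comm (seq x n) (seq y n) } }

  infix 4 _≼ᴿ_

  -- Equivalent to _≤ᴿ_, but in the positive form in which it is easy to use.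
  _≼ᴿ_ : ℝ → ℝ → Set
  x ≼ᴿ y = ∀ ε → 0ℚ < ε → Eventually (λ n → seq x n ≤ seq y n + ε)

  -- One rational term of x - y beyond the modulus is compared with δ = ε/2, which is decidable. If
  -- it is at most δ, the tail stays below ε; if not, the tail stays above δ - γ = γ, so that y < x,
  -- contrary to the hypothesis.
  ≤ᴿ⇒≼ : ∀ {x y} → x ≤ᴿ y → x ≼ᴿ y
  ≤ᴿ⇒≼ {x} {y} x≤y ε 0<ε = conclude (cauchy z γ 0<γ)
    where
    z : ℝ
    z = x -ᴿ y
    δ γ : ℚ
    δ = half ε
    γ = half δ
    0<δ : 0ℚ < δ
    0<δ = 0<half 0<ε
    0<γ : 0ℚ < γ
    0<γ = 0<half 0<δ

    conclude : (∃[ N ] (∀ m n → N ℕ.≤ m → N ℕ.≤ n → ∣ seq z m - seq z n ∣ < γ)) →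
      Eventually (λ n → seq x n ≤ seq y n + ε)
    conclude (N , h) with seq z N ≤? δ
    ... | yes z≤δ = N , λ n n≥ → difference-≤ {seq x n} {seq y n} (begin
      seq z n       ≤⟨ difference-≤ {seq z n} {seq z N} (≤-trans (p≤∣p∣ _) (<⇒≤ (h n N n≥ ℕP.≤-refl))) ⟩
      seq z N + γ   ≤⟨ +-mono-≤ z≤δ (half≤ 0<δ) ⟩
      δ + δ         ≡⟨ half-sum ε ⟩
      ε             ∎)
      where open ≤-Reasoning
    ... | no  z≰δ = contradiction (γ , 0<γ , N , λ n n≥ → subst (seq y n + γ ≤_)
          (solve 2 (λ x y → y :+ (x :- y) := x) refl (seq x n) (seq y n))
          (+-monoʳ-≤ (seq y n) (begin
      γ                 ≡⟨ solve 1 (λ γ → γ := γ :+ γ :- γ) refl γ ⟩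
      γ + γ - γ         ≡⟨ cong (_- γ) (half-sum δ) ⟩
      δ - γ             ≤⟨ +-monoˡ-≤ (- γ) (<⇒≤ (≰⇒> z≰δ)) ⟩
      seq z N - γ       ≤⟨ ≤-difference {seq z N} {γ} (subst (seq z N ≤_) (+-comm (seq z n) γ)
                             (difference-≤ {seq z N} {seq z n} (≤-trans (p≤∣p∣ _) (<⇒≤ (h N n ℕP.≤-refl n≥))))) ⟩
      seq z n           ∎))) x≤y
      where open ≤-Reasoning

  ≼⇒≤ᴿ : ∀ {x y} → x ≼ᴿ y → x ≤ᴿ y
  ≼⇒≤ᴿ {x} {y} x≼y (ε , 0<ε , y+ε≤x) =
    let n , x≤y+ε/2 , y+ε≤x = satisfiable (both (x≼y (half ε) (0<half 0<ε)) y+ε≤x)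
    in <⇒≱ (+-monoʳ-< (seq y n) (half< 0<ε)) (≤-trans y+ε≤x x≤y+ε/2)

  <ᴿ⇒≼ : ∀ {x y} → x <ᴿ y → x ≼ᴿ y
  <ᴿ⇒≼ {x} {y} (δ , 0<δ , x+δ≤y) ε 0<ε = eventually
    (λ n x+δ≤y → begin
      seq x n        ≡⟨ +-identityʳ (seq x n) ⟨
      seq x n + 0ℚ   ≤⟨ +-monoʳ-≤ (seq x n) (<⇒≤ 0<δ) ⟩
      seq x n + δ    ≤⟨ x+δ≤y ⟩
      seq y n        ≡⟨ +-identityʳ (seq y n) ⟨
      seq y n + 0ℚ   ≤⟨ +-monoʳ-≤ (seq y n) (<⇒≤ 0<ε) ⟩
      seq y n + ε    ∎) x+δ≤y
    where open ≤-Reasoning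

  pointwise-≼ : ∀ {x y} → (∀ n → seq x n ≤ seq y n) → x ≼ᴿ y
  pointwise-≼ {x} {y} p ε 0<ε = always λ n →
    ≤-trans (p n) (subst (_≤ seq y n + ε) (+-identityʳ (seq y n)) (+-monoʳ-≤ (seq y n) (<⇒≤ 0<ε)))

  ≈⇒≼ : ∀ {x y} → x ≈ᴿ y → x ≼ᴿ y
  ≈⇒≼ {x} {y} x≈y ε 0<ε = eventually
    (λ n d → difference-≤ {seq x n} {seq y n} (≤-trans (p≤∣p∣ _) (<⇒≤ d))) (x≈y ε 0<ε)

  ≼-trans : ∀ {x y z} → x ≼ᴿ y → y ≼ᴿ z → x ≼ᴿ z
  ≼-trans {x} {y} {z} x≼y y≼z ε 0<ε = eventually₂
    (λ n p q → ≤-trans p (≤-trans (+-monoˡ-≤ (half ε) q) (≤-reflexive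
      (trans (+-assoc (seq z n) (half ε) (half ε)) (cong (λ e → seq z n + e) (half-sum ε))))))
    (x≼y (half ε) (0<half 0<ε)) (y≼z (half ε) (0<half 0<ε))

  +-mono-≼ : ∀ {x y u v} → x ≼ᴿ y → u ≼ᴿ v → x +ᴿ u ≼ᴿ y +ᴿ v
  +-mono-≼ {x} {y} {u} {v} x≼y u≼v ε 0<ε = eventually₂
    (λ n p q → ≤-trans (+-mono-≤ p q) (≤-reflexive
      (trans (+-interchange (seq y n) (half ε) (seq v n) (half ε))
        (cong (λ e → seq y n + seq v n + e) (half-sum ε)))))
    (x≼y (half ε) (0<half 0<ε)) (u≼v (half ε) (0<half 0<ε))

  *-nonneg : ∀ {x y} → 0ᴿ ≼ᴿ x → 0ᴿ ≼ᴿ y → 0ᴿ ≼ᴿ x *ᴿ y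
  *-nonneg {x} {y} 0≼x 0≼y ε 0<ε = conclude (bounded x) (bounded y)
    where
    conclude : Bounded x → Bounded y → Eventually (λ n → 0ℚ ≤ seq x n * seq y n + ε)
    conclude (B , 0<B , x≤B) (C , 0<C , y≤C) = scaled (quotient 0<ε 0<K)
      where
      K : ℚ
      K = B + C + 1ℚ
      0<K : 0ℚ < K
      0<K = 0<-+-0≤ {B + C} {1ℚ} (0<-+-0≤ {B} {C} 0<B (<⇒≤ 0<C)) (<⇒≤ 0<1)

      scaled : (∃[ γ ] 0ℚ < γ × γ * K ≡ ε) → Eventually (λ n → 0ℚ ≤ seq x n * seq y n + ε)
      scaled (γ , 0<γ , γK≡ε) = eventually₂
        (λ n (p , p≤B) (q , q≤C) → ≤-trans
          (product-nonneg {seq x n} {seq y n} {δ} {B} {C} (<⇒≤ 0<δ) (p⊓q≤q γ 1ℚ)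
            (∣-∣≤⇒≤ p≤B) (∣-∣≤⇒≤ q≤C) p q)
          (+-monoʳ-≤ (seq x n * seq y n) δK≤ε))
        (both (0≼x δ 0<δ) x≤B) (both (0≼y δ 0<δ) y≤C)
        where
        δ : ℚ
        δ = γ ⊓ 1ℚ
        0<δ : 0ℚ < δ
        0<δ = 0<⊓ 0<γ 0<1
        δK≤ε : δ * K ≤ ε
        δK≤ε = ≤-trans (*-monoʳ-≤-nonNeg K {{nonNegative (<⇒≤ 0<K)}} (p⊓q≤p γ 1ℚ)) (≤-reflexive γK≡ε)

  -- Eventually y is at least 1/2. A nonpositive p then satisfies p y ≤ p/2, so precision ε/2 for
  -- the product gives precision ε for p.
  nonneg-cancel : ∀ {x y} → 1ᴿ ≼ᴿ y → 0ᴿ ≼ᴿ x *ᴿ y → 0ᴿ ≼ᴿ x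
  nonneg-cancel {x} {y} 1≼y 0≼xy ε 0<ε = eventually₂
    (λ n 1≤y+½ 0≤xy+ → cancel (seq x n) (seq y n) (half≤y (seq y n) 1≤y+½) 0≤xy+)
    (1≼y ½ 0<½) (0≼xy (half ε) (0<half 0<ε))
    where
    half≤y : ∀ q → 1ℚ ≤ q + ½ → ½ ≤ q
    half≤y q h = ≤-difference {1ℚ} {½} (subst (1ℚ ≤_) (+-comm q ½) h)
    cancel : ∀ p q → ½ ≤ q → 0ℚ ≤ p * q + half ε → 0ℚ ≤ p + ε
    cancel p q ½≤q h with ≤-total 0ℚ p
    ... | inj₁ 0≤p = 0≤-+-0≤ {p} {ε} 0≤p (<⇒≤ 0<ε)
    ... | inj₂ p≤0 = *-cancelʳ-≤-pos ½ (begin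
      0ℚ * ½            ≡⟨ *-zeroˡ ½ ⟩
      0ℚ                ≤⟨ h ⟩
      p * q + half ε    ≤⟨ +-monoˡ-≤ (half ε) (*-monoˡ-≤-nonPos p {{nonPositive p≤0}} ½≤q) ⟩
      p * ½ + ε * ½     ≡⟨ *-distribʳ-+ ½ p ε ⟨
      (p + ε) * ½       ∎)
      where open ≤-Reasoning

  0≼√ : ∀ x → 0ᴿ ≼ᴿ √ x
  0≼√ x = pointwise-≼ {0ᴿ} {√ x} λ n → SquareRoot.0≤approx (seq x n ⊔ 0ℚ) n

  -- A nonnegative real may have negative approximations, which `√` truncates to 0. They are
  -- eventually above -ε/2, so truncation shifts them by at most ε/2.
  √-square : ∀ x → 0ᴿ ≼ᴿ x → √ x *ᴿ √ x ≈ᴿ x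
  √-square x 0≼x ε 0<ε = conclude (bounded (√ x))
    where
    open SquareRoot hiding (√)

    conclude : Bounded (√ x) → Eventually (λ n → ∣ seq (√ x) n * seq (√ x) n - seq x n ∣ < ε)
    conclude (B , 0<B , √≤B) =
      scaled (quotient 0<ε (0<-+-0≤ {B + B} {1ℚ} (0<-+-0≤ {B} {B} 0<B (<⇒≤ 0<B)) (<⇒≤ 0<1)))
      where
      scaled : (∃[ δ ] 0ℚ < δ × δ * (B + B + 1ℚ) ≡ ε) →
        Eventually (λ n → ∣ seq (√ x) n * seq (√ x) n - seq x n ∣ < ε)
      scaled (δ , 0<δ , δK≡ε) = eventually₂ close (both √≤B step≤δ) (0≼x (half ε) (0<half 0<ε))
        where
        step≤δ : Eventually (λ n → step n ≤ δ)
        step≤δ = let d , step≤ = archimedean δ 0<δ in d , λ n n≥ → ≤-trans (step-mono {d} {n} n≥) step≤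

        close : ∀ n → ∣ seq (√ x) n ∣ ≤ B × step n ≤ δ → 0ℚ ≤ seq x n + half ε →
          ∣ seq (√ x) n * seq (√ x) n - seq x n ∣ < ε
        close n (s≤B , u≤δ) 0≤x+ε/2 = ∣-∣-<
          (<-difference {s * s} {p} (begin-strict
            s * s          ≤⟨ approx-lower (p ⊔ 0ℚ) n (p≤q⊔p p 0ℚ) ⟩
            p ⊔ 0ℚ         ≤⟨ ⊔-lub p≤p+ε/2 0≤x+ε/2 ⟩
            p + half ε     <⟨ +-monoʳ-< p (half< 0<ε) ⟩
            p + ε          ∎))
          (subst (_< ε) (sym (neg-sub (s * s) p)) (<-difference {p} {s * s} (begin-strict
            p                              ≤⟨ p≤p⊔q p 0ℚ ⟩
            p ⊔ 0ℚ                         <⟨ square-gap {p ⊔ 0ℚ} {s} {step n} {δ} {B} (0≤approx (p ⊔ 0ℚ) n)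
                                                (<⇒≤ (0<step n)) u≤δ (step-mono {0} {n} ℕ.z≤n) (∣-∣≤⇒≤ s≤B)
                                                (approx-upper (p ⊔ 0ℚ) n) ⟩
            s * s + δ * (B + B + 1ℚ)       ≡⟨ cong (λ e → s * s + e) δK≡ε ⟩
            s * s + ε                      ∎)))
          where
          open ≤-Reasoning
          p s : ℚ
          p = seq x n
          s = seq (√ x) n
          p≤p+ε/2 : p ≤ p + half ε
          p≤p+ε/2 = ≤-trans (≤-reflexive (sym (+-identityʳ p))) (+-monoʳ-≤ p (<⇒≤ (0<half 0<ε)))

  orderedRing : OrderedRing
  orderedRing = record
    { commutativeRing = ring
    ; _≼_           = _≼ᴿ_
    ; ≼-reflexive   = λ {x} {y} → ≈⇒≼ {x} {y}
    ; ≼-trans       = λ {x} {y} {z} → ≼-trans {x} {y} {z}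
    ; +-mono-≼      = λ {x} {y} {u} {v} → +-mono-≼ {x} {y} {u} {v}
    ; ι             = ℤ→ℝ
    ; ι-+           = λ i j → pointwise {ℤ→ℝ (i ℤ.+ j)} {ℤ→ℝ i +ᴿ ℤ→ℝ j} λ _ → fromℤ-+ i j
    ; ι-*           = λ i j → pointwise {ℤ→ℝ (i ℤ.* j)} {ℤ→ℝ i *ᴿ ℤ→ℝ j} λ _ → fromℤ-* i j
    ; ι-neg         = λ i → pointwise {ℤ→ℝ (ℤ.- i)} { -ᴿ ℤ→ℝ i} λ _ → fromℤ-neg i
    ; ι-0           = pointwise {ℤ→ℝ (+ 0)} {0ᴿ} λ _ → refl
    ; ι-1           = pointwise {ℤ→ℝ (+ 1)} {1ᴿ} λ _ → refl
    ; ι-mono        = λ {i} {j} i≤j → pointwise-≼ {ℤ→ℝ i} {ℤ→ℝ j} λ _ → fromℤ-mono i≤j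
    ; ι-cancel      = λ i≼j → let (_ , i≤j+½) = satisfiable (i≼j (half 1ℚ) (0<half 0<1)) in fromℤ-cancel i≤j+½
    ; *-nonneg      = λ {x} {y} → *-nonneg {x} {y}
    ; square-nonneg = λ x → pointwise-≼ {0ᴿ} {x *ᴿ x} λ n → Rationals.square-nonneg (seq x n)
    ; nonneg-cancel = λ {x} {y} → nonneg-cancel {x} {y}
    ; halving       = ℚ→ℝ ½ , pointwise {ℤ→ℝ (+ 2) *ᴿ ℚ→ℝ ½} {1ᴿ} λ _ → refl
    ; square-root   = λ x 0≼x → √ x , 0≼√ x , √-square x 0≼x
    }

  -- The inverse is taken of ε₀ ⊔ yₙ, which agrees with yₙ only from `N₀` on; hence an eventual
  -- equality.
  inverse-cancel : ∀ x y (0<y : 0ᴿ <ᴿ y) → (x ÷ᴿ y [ 0<y ]) *ᴿ y ≈ᴿ x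
  inverse-cancel x y 0<y = eventually≡⇒≈ {(x ÷ᴿ y [ 0<y ]) *ᴿ y} {x} (N₀ , λ n n≥ → begin
    seq x n * v n * seq y n     ≡⟨ *-assoc (seq x n) (v n) (seq y n) ⟩
    seq x n * (v n * seq y n)   ≡⟨ cong (λ t → seq x n * (v n * t)) (u≡x n n≥) ⟨
    seq x n * (v n * u n)       ≡⟨ cong (seq x n *_) (trans (*-comm (v n) (u n)) (recip-inv (u n) (0<u n))) ⟩
    seq x n * 1ℚ                ≡⟨ *-identityʳ (seq x n) ⟩
    seq x n                     ∎)
    where
    open ≡-Reasoning
    open Inverse y 0<y

-- Counting solutions by residues.

module Counting (R : OrderedRing) (a b : ℕ) (h : OrderedRing.Carrier R) where
  private module R = OrderedRing R
  open R using (Carrier; _≈_; _+_; _*_; _-_; _≼_; ι)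
  open OrderedRingProperties R
  open Cubic R a b h
  open Orbit a b

  module _ (hq≈1 : h * q ≈ 𝟙) (1≼h : 𝟙 ≼ h) (0<κ : + 1 ℤ.≤ negDisc a b) (1≤a+b : 1 ℕ.≤ a ℕ.+ b) where
    open Root hq≈1 1≼h
    open Definite (≼-respʳ (R.sym (Δ-identity hq≈1)) (R.ι-mono 0<κ))

    orbit-recurrent : ∀ u v w → Recurrent (λ i → ι (+ orbit u v w i))
    orbit-recurrent u v w i = R.trans (R.ι-+ _ _) (R.+-congʳ (R.trans (R.ι-+ _ _)
      (R.+-cong (product a (orbit u v w (2 ℕ.+ i))) (product b (orbit u v w (1 ℕ.+ i))))))
      where
      product : ∀ m n → ι (+ (m ℕ.* n)) ≈ ι (+ m) * ι (+ n)
      product m n = R.trans (R.reflexive (cong ι (ℤP.pos-* m n))) (R.ι-* (+ m) (+ n))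

    ends-at : ∀ {n j} u v w → Dominated j → orbit u v w (2 ℕ.+ j) ≡ n →
      EndsAt j (ι (+ n)) (λ i → ι (+ orbit u v w i))
    ends-at {n} {j} u v w dominated refl = record
      { start = record
        { recurrent = orbit-recurrent u v w
        ; x₀≥0 = ι-nonneg u ; x₁≥0 = ι-nonneg v ; x₂≥0 = ι-nonneg w }
      ; last = R.refl
      ; penultimate = multiple (proj₁ (dominated u v w))
      ; third-last = multiple (proj₂ (dominated u v w))
      }
      where
      multiple : ∀ {x} → x ℕ.≤ suc b ℕ.* n → ι (+ x) ≼ ι (+ suc b) * ι (+ n)
      multiple x≤ = ≼-respʳ (R.trans (R.reflexive (cong ι (ℤP.pos-* (suc b) n))) (R.ι-* (+ suc b) (+ n)))
        (R.ι-mono (ℤ.+≤+ x≤))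

    module _ {n j : ℕ} {m : ℤ} {S : Carrier} (1≤n : 1 ℕ.≤ n) (0≼S : 𝟘 ≼ S)
      (S²≈h³ᵏ : S * S ≈ pow h (3 ℕ.* (3 ℕ.+ j))) (Tn≼mS : (𝟙 + bound) * ι (+ n) ≼ ι m * S) where
      open Threshold 0≼bound (R.ι-mono (ℤ.+≤+ 1≤n)) 0≼S S²≈h³ᵏ Tn≼mS

      Solutions : Vec ℤ (3 ℕ.+ j) → Set
      Solutions = IsPositiveSolution a b 1 n (3 ℕ.+ j)

      j<k : j ℕ.< 3 ℕ.+ j
      j<k = ℕP.m<n+m j (ℕ.s≤s ℕ.z≤n)

      1+j<k : 1 ℕ.+ j ℕ.< 3 ℕ.+ j
      1+j<k = ℕ.s≤s (ℕP.m<n+m j (ℕ.s≤s ℕ.z≤n))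

      same-residue⇒≡ : ∀ m′ .{{_ : ℕ.NonZero m′}} → m ≡ + m′ → ∀ x y → x ℕD.% m′ ≡ y ℕD.% m′ →
        pow h (3 ℕ.* (3 ℕ.+ j)) * ((ι (+ x) - ι (+ y)) * (ι (+ x) - ι (+ y))) ≼ bound * (ι (+ n) * ι (+ n)) →
        x ≡ y
      same-residue⇒≡ m′ refl x y eq bounded with same-residue m′ x y eq
      ... | t , x-y≡tm = ℤP.+-injective (ℤP.i-j≡0⇒i≡j (+ x) (+ y)
        (trans x-y≡tm (cong (ℤ._* + m′) (multiple≡0 t (≼-respˡ (R.*-congˡ (R.*-cong d≈ d≈)) bounded)))))
        where
        d≈ : ι (+ x) - ι (+ y) ≈ ι (t ℤ.* + m′)
        d≈ = R.trans (R.sym (R.trans (R.ι-+ (+ x) (ℤ.- + y)) (R.+-congˡ (R.ι-neg (+ y)))))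
          (R.reflexive (cong ι x-y≡tm))

      residue-injective : Dominated j → ∀ m′ .{{_ : ℕ.NonZero m′}} → m ≡ + m′ →
        ∀ {x y} (X : Solutions x) (Y : Solutions y) →
        let open Solution in
        terms X (1 ℕ.+ j) ℕD.% m′ ≡ terms Y (1 ℕ.+ j) ℕD.% m′ → terms X j ℕD.% m′ ≡ terms Y j ℕD.% m′ → x ≡ y
      residue-injective dominated m′ m≡ X Y eq₁ eq₀ = solution-injective X Y e₁ e₀
        where
        module X = Solution X
        module Y = Solution Y
        open Difference {j = j} (ends-at X.u X.v X.w dominated X.last-term) (ends-at Y.u Y.v Y.w dominated Y.last-term)
          using (penultimate-bound; third-last-bound)
        e₁ : X.terms (1 ℕ.+ j) ≡ Y.terms (1 ℕ.+ j)
        e₁ = same-residue⇒≡ m′ m≡ _ _ eq₁ penultimate-bound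
        e₀ : X.terms j ≡ Y.terms j
        e₀ = same-residue⇒≡ m′ m≡ _ _ eq₀ (third-last-bound
          (R.trans (R.+-congʳ (R.reflexive (cong (λ x → ι (+ x)) e₁))) (R.trans (R.-‿inverseʳ _) (R.sym R.ι-0))))

      -- Defined on all vectors, as the pigeonhole lemma asks, and hence through absolute values; on
      -- solutions these are the orbit terms.
      residues : ∀ m′ .{{_ : ℕ.NonZero m′}} → Vec ℤ (3 ℕ.+ j) → Fin (m′ ℕ.* m′)
      residues m′ x = Fin.combine (residue (fromℕ< 1+j<k)) (residue (fromℕ< j<k))
        where
        residue : Fin (3 ℕ.+ j) → Fin m′
        residue i = fromℕ< (ℕD.m%n<n ℤ.∣ Vec.lookup x i ∣ m′)

      dominated-bound : ∀ {N} → Dominated j → HasCardinality Solutions N → + N ℤ.≤ m ℤ.* m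
      dominated-bound dominated (xs , unique , char , refl) = count m refl m>0
        where
        -- A copy of m is matched on, so that the facts proved about m remain usable through the
        -- equation.
        count : ∀ m′ → m ≡ m′ → + 0 ℤ.< m′ → + length xs ℤ.≤ m′ ℤ.* m′
        count (+ zero)  _  (ℤ.+<+ ())
        count (+ suc m′) m≡ _ = subst (+ length xs ℤ.≤_) (ℤP.pos-* (suc m′) (suc m′))
          (ℤ.+≤+ (unique-length-≤ unique (residues (suc m′)) injective))
          where
          injective : ∀ {x y} → x ∈ xs → y ∈ xs → residues (suc m′) x ≡ residues (suc m′) y → x ≡ y
          injective {x} {y} x∈ y∈ eq with FinP.combine-injective {suc m′} {suc m′} _ _ _ _ eq
          ... | eq₁ , eq₀ = residue-injective dominated (suc m′) m≡ X Y (at (1 ℕ.+ j) 1+j<k eq₁) (at j j<k eq₀)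
            where
            X : Solutions x
            X = Equivalence.to (char x) x∈
            Y : Solutions y
            Y = Equivalence.to (char y) y∈
            at : ∀ i (i<k : i ℕ.< 3 ℕ.+ j) →
              fromℕ< (ℕD.m%n<n ℤ.∣ Vec.lookup x (fromℕ< i<k) ∣ (suc m′)) ≡
              fromℕ< (ℕD.m%n<n ℤ.∣ Vec.lookup y (fromℕ< i<k) ∣ (suc m′)) →
              Solution.terms X i ℕD.% suc m′ ≡ Solution.terms Y i ℕD.% suc m′
            at i i<k e = trans (sym (residue X)) (trans (FinP.fromℕ<-injective _ _ _ _ e) (residue Y))
              where
              residue : ∀ {z} (Z : Solutions z) →
                ℤ.∣ Vec.lookup z (fromℕ< i<k) ∣ ℕD.% suc m′ ≡ Solution.terms Z i ℕD.% suc m′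
              residue Z = cong (λ t → ℤ.∣ t ∣ ℕD.% suc m′) (Solution.lookup-terms Z i i<k)

    cardinality-bound : ∀ {n j m S N} → 1 ℕ.≤ n → 𝟘 ≼ S → S * S ≈ pow h (3 ℕ.* (4 ℕ.+ j)) →
      (𝟙 + bound) * ι (+ n) ≼ ι m * S →
      HasCardinality (IsPositiveSolution a b 1 n (4 ℕ.+ j)) N → + N ℤ.≤ m ℤ.* m
    cardinality-bound {j = j} {m} 1≤n 0≼S S²≈ Tn≼mS card with dominated-or-none a b 1≤a+b j card
    ... | inj₁ dominated = dominated-bound 1≤n 0≼S S²≈ Tn≼mS dominated card
    ... | inj₂ refl      = nonneg m
      where
      nonneg : ∀ m → + 0 ℤ.≤ m ℤ.* m
      nonneg (+ m)    = subst (+ 0 ℤ.≤_) (ℤP.pos-* m m) (ℤ.+≤+ ℕ.z≤n)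
      nonneg -[1+ _ ] = ℤ.+≤+ ℕ.z≤n

  module _ (root : value h ≈ 𝟘) (only : ∀ x → value x ≈ 𝟘 → x ≈ h) (1≼h : 𝟙 ≼ h) (h⋠1 : ¬ h ≼ 𝟙) where
    private
      hq≈1 : h * q ≈ 𝟙
      hq≈1 = root⇒hq≈1 root

    open Root hq≈1 1≼h

    only-root-bound : ∃[ T ] (∀ {n j m S N} → 1 ℕ.≤ n → 𝟘 ≼ S → S * S ≈ pow h (3 ℕ.* (4 ℕ.+ j)) →
      T * ι (+ n) ≼ ι m * S → HasCardinality (IsPositiveSolution a b 1 n (4 ℕ.+ j)) N → + N ℤ.≤ m ℤ.* m)
    only-root-bound = 𝟙 + bound ,
      cardinality-bound hq≈1 1≼h (only-root⇒negDisc>0 only) (h≰1⇒1≤a+b h⋠1)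

-- Specialisation to the reals and the ceiling.

module RealCubic (a b : ℕ) (η : ℝ) (only : IsOnlyRoot (cubic a b 1) η) (1<η : 1ᴿ <ᴿ η) where
  open Reals
  open OrderedRingProperties orderedRing using (𝟙; pow; pow-unique)
  open Cubic orderedRing a b η using (value)

  ^≈pow : ∀ n → η ^ᴿ n ≈ᴿ pow η n
  ^≈pow = pow-unique η (η ^ᴿ_) (pointwise {1ᴿ} {𝟙} λ _ → refl)
    λ n → pointwise {η ^ᴿ suc n} {η *ᴿ η ^ᴿ n} λ _ → refl

  cubic≈value : ∀ x → cubic a b 1 x ≈ᴿ value x
  cubic≈value x = pointwise {cubic a b 1 x} {value x} λ n →
    solve 3 (λ A B x → x :* (x :* (x :* con 1ℚ)) :- A :* (x :* (x :* con 1ℚ)) :- B :* x :- con 1ℚ :=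
      x :* x :* x :- A :* (x :* x) :- B :* x :- con 1ℚ) refl (fromℕ a) (fromℕ b) (seq x n)
    where
    open import Data.Rational.Base using (1ℚ)
    open ℚSolver.+-*-Solver using (solve; con; _:*_; _:-_; _:=_)

  real-bound : ∃[ T ] (∀ {n j m S N} → 1 ℕ.≤ n → 0ᴿ ≼ᴿ S → S *ᴿ S ≈ᴿ pow η (3 ℕ.* (4 ℕ.+ j)) →
    T *ᴿ ℕ→ℝ n ≼ᴿ ℤ→ℝ m *ᴿ S → HasCardinality (IsPositiveSolution a b 1 n (4 ℕ.+ j)) N → + N ℤ.≤ m ℤ.* m)
  real-bound = Counting.only-root-bound orderedRing a b η
    (≈-trans {value η} {cubic a b 1 η} {0ᴿ} (≈-sym {cubic a b 1 η} {value η} (cubic≈value η)) (proj₁ only))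
    (λ x root → proj₂ only x (≈-trans {cubic a b 1 x} {value x} {0ᴿ} (cubic≈value x) root))
    (<ᴿ⇒≼ {1ᴿ} {η} 1<η)
    (λ η≼1 → ≼⇒≤ᴿ {η} {1ᴿ} η≼1 1<η)

  T : ℝ
  T = proj₁ real-bound

  module _ {n j : ℕ} {m : ℤ} where
    k : ℕ
    k = 4 ℕ.+ j

    H S Tn : ℝ
    H = η ^ᴿ (3 ℕ.* k)
    S = η ^½ (3 ℕ.* k)
    Tn = T *ᴿ ℕ→ℝ n

    0<S : 0ᴿ <ᴿ S
    0<S = ^½-pos η (3 ℕ.* k) 1<η

    S²≈η³ᵏ : S *ᴿ S ≈ᴿ pow η (3 ℕ.* k)
    S²≈η³ᵏ = ≈-trans {S *ᴿ S} {H} {pow η (3 ℕ.* k)}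
      (√-square H (<ᴿ⇒≼ {0ᴿ} {H} (^ᴿ-pos η (3 ℕ.* k) (1<⇒pos η 1<η)))) (^≈pow (3 ℕ.* k))

    quotient-≤⇒ : Tn ÷ᴿ S [ 0<S ] ≤ᴿ ℤ→ℝ m → Tn ≼ᴿ ℤ→ℝ m *ᴿ S
    quotient-≤⇒ y≤m = ≼-respˡ {(Tn ÷ᴿ S [ 0<S ]) *ᴿ S} {Tn} {ℤ→ℝ m *ᴿ S} (inverse-cancel Tn S 0<S)
      (*-monoˡ-≼ {Tn ÷ᴿ S [ 0<S ]} {ℤ→ℝ m} {S} (0≼√ H) (≤ᴿ⇒≼ {Tn ÷ᴿ S [ 0<S ]} {ℤ→ℝ m} y≤m))
      where open OrderedRingProperties orderedRing using (≼-respˡ; *-monoˡ-≼)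

    ceiling-bound : ∀ {N} → 1 ℕ.≤ n → HasCardinality (IsPositiveSolution a b 1 n k) N →
      IsCeiling (Tn ÷ᴿ S [ 0<S ]) m → + N ℤ.≤ m ℤ.* m
    ceiling-bound 1≤n card (y≤m , _) =
      proj₂ real-bound {n} {j} {m} {S} 1≤n (0≼√ H) S²≈η³ᵏ (quotient-≤⇒ y≤m) card

open import Data.Nat.Base using (ℕ; _≤_; _*_)

theorem6 : (a b c : ℕ) → c ≡ 1 →
    (η₁ : ℝ) → IsOnlyRoot (cubic a b c) η₁ → (1<η₁ : 1ᴿ <ᴿ η₁) →
    ∃[ T ] ((n k : ℕ) → 1 ≤ n → 4 ≤ k →
    (N : ℕ) → HasCardinality (IsPositiveSolution a b c n k) N →
    (m : ℤ) →
    IsCeiling ((T *ᴿ ℕ→ℝ n) ÷ᴿ (η₁ ^½ (3 * k)) [ ^½-pos η₁ (3 * k) 1<η₁ ]) m →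
    + N ℤ.≤ m ℤ.* m)
theorem6 a b .1 refl η₁ only 1<η₁ = T , λ where
    n _ 1≤n (ℕ.s≤s (ℕ.s≤s (ℕ.s≤s (ℕ.s≤s (ℕ.z≤n {j}))))) N card m ceiling → ceiling-bound {n} {j} {m} 1≤n card ceiling
  where open RealCubic a b η₁ only 1<η₁
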